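{- Let $\xi$ be a transcendental real number. For every positive integer $k$, $$(k+1) \bigl( 1 + \lambda_{k+1} (\xi) \bigr) \ge k \bigl( 1 + \lambda_k (\xi) \bigr).$$ Consequently, for every integer $n \ge k$, $$\lambda_n (\xi) \ge \frac{k \lambda_k (\xi) - n + k}{n}.$$
   Context: For an integer $n \ge 1$ and a real number $\xi$, $\lambda_n(\xi)$ denotes the supremum (possibly $+\infty$) of the real numbers $\lambda$ such that, for arbitrarily large real numbers $X$, the inequalities $0 < |x_0| \le X$, $\max_{1 \le m \le n} |x_0 \xi^m - x_m| \le X^{ -\lambda}$ have a solution in integers $x_0, \ldots, x_n$. The inequalities are understood in the extended reals (if $\lambda_k(\xi)=+\infty$ then the right-hand sides are $+\infty$). -}

module Defs where

open import Data.Fin.Base as Fin using (Fin; toℕ)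
open import Data.Integer.Base as ℤ using (ℤ; +_; _⊖_; 0ℤ)
open import Data.List.Base using (List; []; _∷_)
open import Data.List.Relation.Unary.Any using (Any)
open import Data.Nat.Base as ℕ using (ℕ; zero; suc)
import Data.Nat.Properties as ℕ
open import Data.Product.Base using (Σ-syntax; ∃-syntax; _×_; _,_)
open import Data.Rational.Base
open import Data.Rational.Properties
open import Data.Rational.Solver using (module +-*-Solver)
open import Data.Sum.Base using (inj₁; inj₂)
open import Relation.Binary.PropositionalEquality using (_≡_; _≢_; refl; sym; trans; cong; subst; subst₂)
open import Relation.Nullary.Negation.Core using (¬_)

-- Real numbers are Cauchy sequences of rationals, with equality _≃ℝ_.

IsCauchy : (ℕ → ℚ) → Set
IsCauchy x = ∀ ε → 0ℚ < ε →
  ∃[ N ] (∀ m n → N ℕ.≤ m → N ℕ.≤ n → ∣ x m - x n ∣ ≤ ε)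

record ℝ : Set where
  constructor mkℝ
  field
    seq    : ℕ → ℚ
    cauchy : IsCauchy seq

open ℝ public

infix 4 _≤ℝ_ _<ℝ_ _≃ℝ_

_≤ℝ_ : ℝ → ℝ → Set
x ≤ℝ y = ∀ ε → 0ℚ < ε → ∃[ N ] (∀ n → N ℕ.≤ n → seq x n ≤ seq y n + ε)

_<ℝ_ : ℝ → ℝ → Set
x <ℝ y = ∃[ ε ] (0ℚ < ε × ∃[ N ] (∀ n → N ℕ.≤ n → seq x n + ε ≤ seq y n))

_≃ℝ_ : ℝ → ℝ → Set
x ≃ℝ y = ∀ ε → 0ℚ < ε → ∃[ N ] (∀ n → N ℕ.≤ n → ∣ seq x n - seq y n ∣ ≤ ε)

private

  open +-*-Solver using (solve; _:+_; _:*_; :-_; _:-_; _:=_)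

  add-sub : ∀ u v → (u + v) - v ≡ u
  add-sub = solve 2 (λ u v → (u :+ v) :- v := u) refl

  sub-add : ∀ u v → (u - v) + v ≡ u
  sub-add = solve 2 (λ u v → (u :- v) :+ v := u) refl

  sub-swap : ∀ u v → u - v ≡ - (v - u)
  sub-swap = solve 2 (λ u v → u :- v := :- (v :- u)) refl

  neg-sub : ∀ u v → - (u - v) ≡ - u - - v
  neg-sub = solve 2 (λ u v → :- (u :- v) := :- u :- :- v) refl

  sub-+ : ∀ a b c d → (a - b) + (c - d) ≡ (a + c) - (b + d)
  sub-+ = solve 4 (λ a b c d → (a :- b) :+ (c :- d) := (a :+ c) :- (b :+ d)) refl

  sub-* : ∀ a b c d → a * (c - d) + (a - b) * d ≡ a * c - b * d
  sub-* = solve 4 (λ a b c d → a :* (c :- d) :+ (a :- b) :* d := a :* c :- b :* d) refl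

  factor : ∀ b c d → b * d + d * c ≡ (b + c) * d
  factor = solve 3 (λ b c d → b :* d :+ d :* c := (b :+ c) :* d) refl

  half-pos : ∀ {ε} → 0ℚ < ε → 0ℚ < ½ * ε
  half-pos {ε} 0<ε = subst (_< ½ * ε) (*-zeroʳ ½) (*-monoʳ-<-pos ½ 0<ε)

  half+half : ∀ ε → ½ * ε + ½ * ε ≡ ε
  half+half ε = trans (sym (*-distribʳ-+ ε ½ ½)) (*-identityˡ ε)

  reverse-triangle : ∀ a b → ∣ a ∣ - ∣ b ∣ ≤ ∣ a - b ∣
  reverse-triangle a b = subst (∣ a ∣ - ∣ b ∣ ≤_)
    (add-sub ∣ a - b ∣ ∣ b ∣)
    (+-monoˡ-≤ (- ∣ b ∣)
      (subst (λ t → ∣ t ∣ ≤ ∣ a - b ∣ + ∣ b ∣)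
        (sub-add a b)
        (∣p+q∣≤∣p∣+∣q∣ (a - b) b)))

  abs-diff : ∀ a b → ∣ ∣ a ∣ - ∣ b ∣ ∣ ≤ ∣ a - b ∣
  abs-diff a b with ∣p∣≡p∨∣p∣≡-p (∣ a ∣ - ∣ b ∣)
  ... | inj₁ eq = subst (_≤ ∣ a - b ∣) (sym eq) (reverse-triangle a b)
  ... | inj₂ eq = subst₂ _≤_
      (trans (sub-swap ∣ b ∣ ∣ a ∣) (sym eq))
      (trans (cong ∣_∣ (sub-swap b a)) (∣-p∣≡∣p∣ (a - b)))
      (reverse-triangle b a)

  +-cauchy : ∀ {x y} → IsCauchy x → IsCauchy y → IsCauchy (λ n → x n + y n)
  +-cauchy {x} {y} cx cy ε 0<ε with cx (½ * ε) (half-pos 0<ε) | cy (½ * ε) (half-pos 0<ε)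
  ... | M , hM | N , hN = M ℕ.⊔ N , λ m n K≤m K≤n →
    subst₂ (λ s t → ∣ s ∣ ≤ t)
      (sub-+ (x m) (x n) (y m) (y n))
      (half+half ε)
      (≤-trans (∣p+q∣≤∣p∣+∣q∣ (x m - x n) (y m - y n))
        (+-mono-≤
          (hM m n (ℕ.m⊔n≤o⇒m≤o M N K≤m) (ℕ.m⊔n≤o⇒m≤o M N K≤n))
          (hN m n (ℕ.m⊔n≤o⇒n≤o M N K≤m) (ℕ.m⊔n≤o⇒n≤o M N K≤n))))

  neg-cauchy : ∀ {x} → IsCauchy x → IsCauchy (λ n → - x n)
  neg-cauchy {x} cx ε 0<ε with cx ε 0<ε
  ... | N , h = N , λ m n N≤m N≤n →
    subst (_≤ ε)
      (trans (sym (∣-p∣≡∣p∣ (x m - x n)))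
        (cong ∣_∣ (neg-sub (x m) (x n))))
      (h m n N≤m N≤n)

  abs-cauchy : ∀ {x} → IsCauchy x → IsCauchy (λ n → ∣ x n ∣)
  abs-cauchy {x} cx ε 0<ε with cx ε 0<ε
  ... | N , h = N , λ m n N≤m N≤n → ≤-trans (abs-diff (x m) (x n)) (h m n N≤m N≤n)

  EventuallyBounded : (ℕ → ℚ) → Set
  EventuallyBounded x = ∃[ B ] (0ℚ < B × ∃[ N ] (∀ n → N ℕ.≤ n → ∣ x n ∣ ≤ B))

  bounded : ∀ {x} → IsCauchy x → EventuallyBounded x
  bounded {x} cx with cx 1ℚ (positive⁻¹ 1ℚ)
  ... | N , h = 1ℚ + ∣ x N ∣ , +-mono-<-≤ (positive⁻¹ 1ℚ) (0≤∣p∣ (x N)) , N , λ n N≤n →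
    ≤-trans
      (subst (λ t → ∣ t ∣ ≤ ∣ x n - x N ∣ + ∣ x N ∣)
        (sub-add (x n) (x N))
        (∣p+q∣≤∣p∣+∣q∣ (x n - x N) (x N)))
      (+-monoˡ-≤ ∣ x N ∣ (h n N N≤n ℕ.≤-refl))

  *-mono-≤ℚ : ∀ {a b c d} → 0ℚ ≤ a → 0ℚ ≤ d → a ≤ b → c ≤ d → a * c ≤ b * d
  *-mono-≤ℚ {a} {b} {c} {d} 0≤a 0≤d a≤b c≤d = ≤-trans
    (*-monoˡ-≤-nonNeg a {{nonNegative 0≤a}} c≤d)
    (*-monoʳ-≤-nonNeg d {{nonNegative 0≤d}} a≤b)

  pos+pos : ∀ {p q} → 0ℚ < p → 0ℚ < q → 0ℚ < p + q
  pos+pos {p} {q} 0<p 0<q = <-trans 0<p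
    (subst (_< p + q) (+-identityʳ p) (+-monoʳ-< p 0<q))

  divide : ∀ S ε → 0ℚ < S → 0ℚ < ε → ∃[ δ ] (0ℚ < δ × S * δ ≡ ε)
  divide S ε 0<S 0<ε = S⁻¹ * ε , 0<δ , Sδ≡ε
    where
    posS : Positive S
    posS = positive 0<S
    S⁻¹ : ℚ
    S⁻¹ = (1/ S) {{pos⇒nonZero S {{posS}}}}
    0<δ : 0ℚ < S⁻¹ * ε
    0<δ = subst (_< S⁻¹ * ε) (*-zeroʳ S⁻¹)
            (*-monoʳ-<-pos S⁻¹ {{1/pos⇒pos S {{posS}}}} 0<ε)
    Sδ≡ε : S * (S⁻¹ * ε) ≡ ε
    Sδ≡ε = trans (sym (*-assoc S S⁻¹ ε))
      (trans (cong (_* ε) (*-inverseʳ S {{pos⇒nonZero S {{posS}}}})) (*-identityˡ ε))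

  *-close : ∀ {B C δ ε} a b c d → 0ℚ ≤ C → 0ℚ ≤ δ → (B + C) * δ ≡ ε →
            ∣ a ∣ ≤ B → ∣ d ∣ ≤ C → ∣ a - b ∣ ≤ δ → ∣ c - d ∣ ≤ δ →
            ∣ a * c - b * d ∣ ≤ ε
  *-close {B} {C} {δ} {ε} a b c d 0≤C 0≤δ eq a≤B d≤C a-b≤δ c-d≤δ = begin
    ∣ a * c - b * d ∣                     ≡⟨ cong ∣_∣ (sub-* a b c d) ⟨
    ∣ a * (c - d) + (a - b) * d ∣         ≤⟨ ∣p+q∣≤∣p∣+∣q∣ (a * (c - d)) ((a - b) * d) ⟩
    ∣ a * (c - d) ∣ + ∣ (a - b) * d ∣     ≤⟨ +-mono-≤ left right ⟩
    B * δ + δ * C                         ≡⟨ factor B C δ ⟩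
    (B + C) * δ                           ≡⟨ eq ⟩
    ε                                     ∎
    where
    open ≤-Reasoning
    left : ∣ a * (c - d) ∣ ≤ B * δ
    left = subst (_≤ B * δ) (sym (∣p*q∣≡∣p∣*∣q∣ a (c - d)))
             (*-mono-≤ℚ (0≤∣p∣ a) 0≤δ a≤B c-d≤δ)
    right : ∣ (a - b) * d ∣ ≤ δ * C
    right = subst (_≤ δ * C) (sym (∣p*q∣≡∣p∣*∣q∣ (a - b) d))
              (*-mono-≤ℚ (0≤∣p∣ (a - b)) 0≤C a-b≤δ d≤C)

  *-cauchy : ∀ {x y} → IsCauchy x → IsCauchy y → IsCauchy (λ n → x n * y n)
  *-cauchy {x} {y} cx cy ε 0<ε = go₁ (bounded {x} cx) (bounded {y} cy)
    where
    Close : (ℕ → ℚ) → ℚ → Set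
    Close z η = ∃[ N ] (∀ m n → N ℕ.≤ m → N ℕ.≤ n → ∣ z m - z n ∣ ≤ η)

    module _ {B C δ : ℚ} {K L : ℕ} (0<C : 0ℚ < C) (0<δ : 0ℚ < δ) (eq : (B + C) * δ ≡ ε)
             (hB : ∀ n → K ℕ.≤ n → ∣ x n ∣ ≤ B) (hC : ∀ n → L ℕ.≤ n → ∣ y n ∣ ≤ C) where

      go₃ : Close x δ → Close y δ → Close (λ n → x n * y n) ε
      go₃ (M , hM) (N , hN) = (K ℕ.⊔ L) ℕ.⊔ (M ℕ.⊔ N) , λ m n P≤m P≤n →
        let KL≤m = ℕ.m⊔n≤o⇒m≤o (K ℕ.⊔ L) (M ℕ.⊔ N) P≤m
            KL≤n = ℕ.m⊔n≤o⇒m≤o (K ℕ.⊔ L) (M ℕ.⊔ N) P≤n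
            MN≤m = ℕ.m⊔n≤o⇒n≤o (K ℕ.⊔ L) (M ℕ.⊔ N) P≤m
            MN≤n = ℕ.m⊔n≤o⇒n≤o (K ℕ.⊔ L) (M ℕ.⊔ N) P≤n
        in *-close {B} {C} {δ} {ε} (x m) (x n) (y m) (y n) (<⇒≤ 0<C) (<⇒≤ 0<δ) eq
             (hB m (ℕ.m⊔n≤o⇒m≤o K L KL≤m))
             (hC n (ℕ.m⊔n≤o⇒n≤o K L KL≤n))
             (hM m n (ℕ.m⊔n≤o⇒m≤o M N MN≤m) (ℕ.m⊔n≤o⇒m≤o M N MN≤n))
             (hN m n (ℕ.m⊔n≤o⇒n≤o M N MN≤m) (ℕ.m⊔n≤o⇒n≤o M N MN≤n))

    go₁ : EventuallyBounded x → EventuallyBounded y → Close (λ n → x n * y n) ε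
    go₁ (B , 0<B , K , hB) (C , 0<C , L , hC) = go₂ (divide (B + C) ε (pos+pos 0<B 0<C) 0<ε)
      where
      go₂ : ∃[ δ ] (0ℚ < δ × (B + C) * δ ≡ ε) → Close (λ n → x n * y n) ε
      go₂ (δ , 0<δ , eq) = go₃ {B} {C} {δ} {K} {L} 0<C 0<δ eq hB hC (cx δ 0<δ) (cy δ 0<δ)

infixl 6 _+ℝ_ _-ℝ_
infixl 7 _*ℝ_
infix  8 -ℝ_
infixr 8 _^ℝ_

fromℚ : ℚ → ℝ
fromℚ q = mkℝ (λ _ → q) (λ ε 0<ε → 0 , λ _ _ _ _ →
  subst (λ t → ∣ t ∣ ≤ ε) (sym (+-inverseʳ q)) (<⇒≤ 0<ε))

fromℤ : ℤ → ℝ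
fromℤ a = fromℚ (a / 1)

0ℝ 1ℝ : ℝ
0ℝ = fromℚ 0ℚ
1ℝ = fromℚ 1ℚ

_+ℝ_ : ℝ → ℝ → ℝ
x +ℝ y = mkℝ (λ n → seq x n + seq y n) (+-cauchy {seq x} {seq y} (cauchy x) (cauchy y))

-ℝ_ : ℝ → ℝ
-ℝ x = mkℝ (λ n → - seq x n) (neg-cauchy {seq x} (cauchy x))

_-ℝ_ : ℝ → ℝ → ℝ
x -ℝ y = x +ℝ (-ℝ y)

_*ℝ_ : ℝ → ℝ → ℝ
x *ℝ y = mkℝ (λ n → seq x n * seq y n) (*-cauchy {seq x} {seq y} (cauchy x) (cauchy y))

∣_∣ℝ : ℝ → ℝ
∣ x ∣ℝ = mkℝ (λ n → ∣ seq x n ∣) (abs-cauchy {seq x} (cauchy x))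

_^ℝ_ : ℝ → ℕ → ℝ
x ^ℝ zero  = 1ℝ
x ^ℝ suc n = x *ℝ (x ^ℝ n)

-- For X ≥ 1, IsPower X t y says y = X^t.  It is the usual description of a real
-- power as the value squeezed between the rational powers: X^r ≤ y for rational
-- r < t and y ≤ X^r for rational r > t.  A rational is written r = (a - c)/b with
-- a, c, b ∈ ℕ and b > 0, and since y > 0 the inequality X^r ≤ y reads
-- X^a ≤ X^c y^b.  These conditions determine y uniquely.
record IsPower (X t y : ℝ) : Set where
  field
    y>0      : 0ℝ <ℝ y
    lower    : ∀ a c b .{{_ : ℕ.NonZero b}} → fromℚ ((a ⊖ c) / b) <ℝ t →
               X ^ℝ a ≤ℝ (X ^ℝ c) *ℝ (y ^ℝ b)
    upper    : ∀ a c b .{{_ : ℕ.NonZero b}} → t <ℝ fromℚ ((a ⊖ c) / b) →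
               (X ^ℝ c) *ℝ (y ^ℝ b) ≤ℝ X ^ℝ a

evalPoly : List ℤ → ℝ → ℝ
evalPoly []      x = 0ℝ
evalPoly (a ∷ p) x = fromℤ a +ℝ x *ℝ evalPoly p x

Algebraic : ℝ → Set
Algebraic x = Σ[ p ∈ List ℤ ] (Any (_≢ 0ℤ) p × evalPoly p x ≃ℝ 0ℝ)

Transcendental : ℝ → Set
Transcendental x = ¬ Algebraic x

-- Extended reals, as open lower sets of rationals: z ∈ [-∞, +∞] is
-- { q ∈ ℚ : q < z }, so -∞ is the empty set and +∞ is all of ℚ.  In this
-- representation every set of reals has a supremum, also constructively.

record ℝ∞ : Set₁ where
  field
    below     : ℚ → Set
    downwards : ∀ {p q} → p ≤ q → below q → below p
    open-set  : ∀ {p} → below p → ∃[ q ] (p < q × below q)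

open ℝ∞ public

infix 4 _≤∞_ _≥∞_

_≤∞_ _≥∞_ : ℝ∞ → ℝ∞ → Set
A ≤∞ B = ∀ q → below A q → below B q
A ≥∞ B = B ≤∞ A

fromℝ : ℝ → ℝ∞
fromℝ x = record
  { below     = λ q → fromℚ q <ℝ x
  ; downwards = λ { p≤q (ε , 0<ε , N , h) →
      ε , 0<ε , N , λ n N≤n → ≤-trans (+-monoˡ-≤ ε p≤q) (h n N≤n) }
  ; open-set  = λ { {p} (ε , 0<ε , N , h) →
      p + ½ * ε ,
      subst (_< p + ½ * ε) (+-identityʳ p) (+-monoʳ-< p (half-pos 0<ε)) ,
      ½ * ε , half-pos 0<ε , N , λ n N≤n →
        subst (_≤ seq x n)
          (trans (cong (λ t → p + t) (sym (half+half ε))) (sym (+-assoc p (½ * ε) (½ * ε))))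
          (h n N≤n) }
  }

sup : (ℝ → Set) → ℝ∞
sup S = record
  { below     = λ q → ∃[ s ] (S s × below (fromℝ s) q)
  ; downwards = λ { p≤q (s , Ss , q<s) → s , Ss , downwards (fromℝ s) p≤q q<s }
  ; open-set  = λ { (s , Ss , p<s) →
      let (q , p<q , q<s) = open-set (fromℝ s) p<s in q , p<q , s , Ss , q<s }
  }

sup-upper : ∀ S {s} → S s → fromℝ s ≤∞ sup S
sup-upper S Ss q q<s = _ , Ss , q<s

sup-least : ∀ S A → (∀ s → S s → fromℝ s ≤∞ A) → sup S ≤∞ A
sup-least S A h q (s , Ss , q<s) = h s Ss q q<s

infixr 6 _⊕_
infixr 7 _·_
infixl 7 _÷∞_

_⊕_ : ℚ → ℝ∞ → ℝ∞
r ⊕ A = record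
  { below     = λ q → ∃[ a ] (below A a × q ≤ r + a)
  ; downwards = λ { p≤q (a , Aa , q≤) → a , Aa , ≤-trans p≤q q≤ }
  ; open-set  = λ { (a , Aa , p≤) →
      let (b , a<b , Ab) = open-set A Aa
      in r + b , ≤-<-trans p≤ (+-monoʳ-< r a<b) , b , Ab , ≤-refl }
  }

scale : (c : ℚ) → .{{Positive c}} → ℝ∞ → ℝ∞
scale c A = record
  { below     = λ q → ∃[ a ] (below A a × q ≤ c * a)
  ; downwards = λ { p≤q (a , Aa , q≤) → a , Aa , ≤-trans p≤q q≤ }
  ; open-set  = λ { (a , Aa , p≤) →
      let (b , a<b , Ab) = open-set A Aa
      in c * b , ≤-<-trans p≤ (*-monoʳ-<-pos c a<b) , b , Ab , ≤-refl }
  }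

_·_ : (k : ℕ) → .{{ℕ.NonZero k}} → ℝ∞ → ℝ∞
k · A = scale (+ k / 1) {{normalize-pos k 1}} A

_÷∞_ : ℝ∞ → (n : ℕ) → .{{ℕ.NonZero n}} → ℝ∞
A ÷∞ n = scale (+ 1 / n) {{normalize-pos 1 n}} A

-- x solves 0 < |x₀| ≤ X and max_{1 ≤ m ≤ n} |x₀ ξ^m - x_m| ≤ Y; the index
-- m ∈ {1, …, n} is Fin.suc i with i : Fin n.
Solution : (n : ℕ) (ξ X Y : ℝ) → (Fin (suc n) → ℤ) → Set
Solution n ξ X Y x =
    0ℝ <ℝ ∣ fromℤ x₀ ∣ℝ
  × ∣ fromℤ x₀ ∣ℝ ≤ℝ X
  × (∀ (i : Fin n) → let m = Fin.suc i in
       ∣ fromℤ x₀ *ℝ (ξ ^ℝ toℕ m) -ℝ fromℤ (x m) ∣ℝ ≤ℝ Y)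
  where
  x₀ : ℤ
  x₀ = x Fin.zero

-- X ≥ 1 only serves to make the real power X^(-λ) meaningful; X is
-- arbitrarily large in any case.
Admissible : (n : ℕ) (ξ lam : ℝ) → Set
Admissible n ξ lam = ∀ (B : ℝ) →
  ∃[ X ] (B ≤ℝ X × 1ℝ ≤ℝ X ×
    ∃[ Y ] (IsPower X (-ℝ lam) Y × ∃[ x ] Solution n ξ X Y x))

-- λ_n(ξ), meant for n ≥ 1.
λ[_] : ℕ → ℝ → ℝ∞
λ[ n ] ξ = sup (Admissible n ξ)

{-# OPTIONS --safe #-}

-- Let x = (x₀, …, x_k) satisfy |x₀ ξⁱ - xᵢ| ≤ Y with |x₀| ≤ X.  By Siegel's lemma there are
-- integers aᵢ, not all zero and of size O(X^(1/k)), with a₀ x₀ + … + a_k x_k = 0.  If a_d is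
-- the last nonzero one and s = k + 1 - d, the relation says that Σ aᵢ ξⁱ is small, and hence
-- so is ξ^s Σ aᵢ ξⁱ, which expresses a_d x₀ ξ^(k+1) through lower powers of ξ.  Therefore
-- y = (a_d x₀, …, a_d x_k, -Σ_{i<d} aᵢ x_{i+s}) satisfies |y₀| = O(X^(1+1/k)) and
-- |y₀ ξʲ - yⱼ| = O(X^(1/k) Y) for j ≤ k + 1, which is the first inequality; the second is
-- its iteration.  Constants are absorbed since λ_k is only approached from below.
module Submission where

open import Defs
open import Data.Fin.Base as Fin using (Fin; toℕ)
import Data.Fin.Properties as Fin
open import Data.Integer.Base as ℤ using (ℤ; +_; -[1+_]; _⊖_; 0ℤ; 1ℤ; -1ℤ)
import Data.Integer.Properties as ℤ
import Data.Integer.Tactic.RingSolver as ℤ-Ring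
open import Data.Nat.Base as ℕ using (ℕ; zero; suc)
import Data.Nat.Coprimality as ℕ
import Data.Nat.Properties as ℕ
import Data.Nat.Tactic.RingSolver as ℕ-Ring
open import Data.Product.Base using (∃-syntax; _×_; _,_; proj₁; proj₂)
open import Data.Rational.Base
open import Data.Rational.Properties
open import Data.Rational.Solver using (module +-*-Solver)
import Data.Rational.Unnormalised.Base as ℚᵘ
import Data.Rational.Unnormalised.Properties as ℚᵘ
open import Data.Sum.Base using (_⊎_; inj₁; inj₂)
open import Function.Base using (_∘_)
open import Relation.Binary.PropositionalEquality
open import Relation.Nullary.Decidable.Core using (Dec; yes; no)
open import Relation.Nullary.Negation.Core using (¬_; contradiction)
open import Algebra.Bundles using (CommutativeRing)
open import Algebra.Properties.CommutativeSemiring.Exp (CommutativeRing.commutativeSemiring +-*-commutativeRing) using (_^_; ^-homo-*; ^-distrib-*)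

open +-*-Solver using (solve; _:+_; _:*_; :-_; _:-_; _:=_; con)

-- Real powers and roots are avoided by letting `X` run through powers of two only: along
-- `X = 2^(k b m)` the Siegel bound is `2^(b m)` up to a constant, and sizes, accuracies and
-- constants are all compared as natural exponents. Each passage, from real `X` to powers of two and
-- from `k` to `k + 1`, costs one unit of a numerator whose denominator may be taken as large as
-- desired, and that unit pays for the constants. The integers of a solution are fixed, while `ξ` is
-- known only through rational terms `z` of its sequence. Hence all estimates are proved for
-- rational `z` and asserted for all late terms. Errors must be at most `1` for the coordinates to
-- be of the size of `x₀`, so the argument covers nonnegative exponents; negative rationals are
-- handled apart, by the vector `(1, 0, …, 0)`. The suprema are compared rational by rational, so
-- the value `+∞` needs no separate case.

-- Integers inside the rationals.

-- Opaque, so that unification does not unfold the normalisation in _/_.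
opaque
  ⟦_⟧ : ℤ → ℚ
  ⟦ a ⟧ = a / 1

  ⟦⟧≡/1 : ∀ a → ⟦ a ⟧ ≡ a / 1
  ⟦⟧≡/1 a = refl

ι : ℕ → ℚ
ι n = ⟦ + n ⟧

private

  -- The reduced form of `a / 1`: sums and products of such fractions unfold to a single quotient by
  -- `1`.
  int : ℤ → ℚ
  int a = mkℚ a 0 (ℕ.sym (ℕ.1-coprimeTo ℤ.∣ a ∣))

  ⟦⟧≡int : ∀ a → ⟦ a ⟧ ≡ int a
  ⟦⟧≡int a = trans (⟦⟧≡/1 a) (↥p/↧p≡p (int a))

⟦⟧-+ : ∀ a b → ⟦ a ℤ.+ b ⟧ ≡ ⟦ a ⟧ + ⟦ b ⟧
⟦⟧-+ a b = begin
  ⟦ a ℤ.+ b ⟧                       ≡⟨ cong ⟦_⟧ (cong₂ ℤ._+_ (ℤ.*-identityʳ a) (ℤ.*-identityʳ b)) ⟨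
  ⟦ a ℤ.* + 1 ℤ.+ b ℤ.* + 1 ⟧       ≡⟨ ⟦⟧≡/1 _ ⟩
  int a + int b                     ≡⟨ cong₂ _+_ (⟦⟧≡int a) (⟦⟧≡int b) ⟨
  ⟦ a ⟧ + ⟦ b ⟧                     ∎
  where open ≡-Reasoning

⟦⟧-* : ∀ a b → ⟦ a ℤ.* b ⟧ ≡ ⟦ a ⟧ * ⟦ b ⟧
⟦⟧-* a b = trans (⟦⟧≡/1 (a ℤ.* b)) (sym (cong₂ _*_ (⟦⟧≡int a) (⟦⟧≡int b)))

⟦⟧-neg : ∀ a → ⟦ ℤ.- a ⟧ ≡ - ⟦ a ⟧
⟦⟧-neg a = begin
  ⟦ ℤ.- a ⟧                       ≡⟨ solve 2 (λ p q → q := (p :+ q) :- p) refl ⟦ a ⟧ ⟦ ℤ.- a ⟧ ⟩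
  (⟦ a ⟧ + ⟦ ℤ.- a ⟧) - ⟦ a ⟧     ≡⟨ cong (_- ⟦ a ⟧) (⟦⟧-+ a (ℤ.- a)) ⟨
  ⟦ a ℤ.+ ℤ.- a ⟧ - ⟦ a ⟧         ≡⟨ cong (λ b → ⟦ b ⟧ - ⟦ a ⟧) (ℤ.+-inverseʳ a) ⟩
  ⟦ 0ℤ ⟧ - ⟦ a ⟧                  ≡⟨ cong (_- ⟦ a ⟧) (⟦⟧≡/1 0ℤ) ⟩
  0ℚ - ⟦ a ⟧                      ≡⟨ +-identityˡ (- ⟦ a ⟧) ⟩
  - ⟦ a ⟧                         ∎
  where open ≡-Reasoning

⟦⟧-∣∣ : ∀ a → ∣ ⟦ a ⟧ ∣ ≡ ι ℤ.∣ a ∣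
⟦⟧-∣∣ a = trans (cong ∣_∣ (⟦⟧≡int a)) (sym (⟦⟧≡int (+ ℤ.∣ a ∣)))

ι-+ : ∀ m n → ι (m ℕ.+ n) ≡ ι m + ι n
ι-+ m n = trans (cong ⟦_⟧ (ℤ.pos-+ m n)) (⟦⟧-+ (+ m) (+ n))

ι-* : ∀ m n → ι (m ℕ.* n) ≡ ι m * ι n
ι-* m n = trans (cong ⟦_⟧ (ℤ.pos-* m n)) (⟦⟧-* (+ m) (+ n))

ι-^ : ∀ m n → ι (m ℕ.^ n) ≡ ι m ^ n
ι-^ m zero    = ⟦⟧≡/1 1ℤ
ι-^ m (suc n) = trans (ι-* m (m ℕ.^ n)) (cong (ι m *_) (ι-^ m n))

⟦⟧-⊖ : ∀ m n → ⟦ m ⊖ n ⟧ ≡ ι m - ι n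
⟦⟧-⊖ m n = trans (cong ⟦_⟧ (sym (ℤ.m-n≡m⊖n m n)))
  (trans (⟦⟧-+ (+ m) (ℤ.- + n)) (cong (λ p → ι m + p) (⟦⟧-neg (+ n))))

ι-mono : ∀ {m n} → m ℕ.≤ n → ι m ≤ ι n
ι-mono {m} {n} m≤n = subst₂ _≤_ (sym (⟦⟧≡int (+ m))) (sym (⟦⟧≡int (+ n)))
  (*≤* (ℤ.*-monoʳ-≤-nonNeg (+ 1) (ℤ.+≤+ m≤n)))

ι-cancel-≤ : ∀ {m n} → ι m ≤ ι n → m ℕ.≤ n
ι-cancel-≤ {m} {n} m≤n = ℤ.drop‿+≤+ (ℤ.*-cancelʳ-≤-pos _ _ (+ 1)
  (drop-*≤* (subst₂ _≤_ (⟦⟧≡int (+ m)) (⟦⟧≡int (+ n)) m≤n)))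

0≤ι : ∀ n → 0ℚ ≤ ι n
0≤ι n = subst (_≤ ι n) (⟦⟧≡/1 0ℤ) (ι-mono ℕ.z≤n)

ι-mono-< : ∀ {m n} → m ℕ.< n → ι m < ι n
ι-mono-< {m} {n} m<n = ≰⇒> (λ n≤m → ℕ.<⇒≱ m<n (ι-cancel-≤ n≤m))

0<ι : ∀ n .{{_ : ℕ.NonZero n}} → 0ℚ < ι n
0<ι (suc n) = subst (_< ι (suc n)) (⟦⟧≡/1 0ℤ) (ι-mono-< ℕ.z<s)

-- The proof passes through unnormalised rationals because the reduced form of `a / n` does not
-- compute for variable `a` and `n`.
/-*-cancel : ∀ a n .{{_ : ℕ.NonZero n}} → (a / n) * ι n ≡ ⟦ a ⟧
/-*-cancel a (suc n) = toℚᵘ-injective (begin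
  toℚᵘ ((a / suc n) * ι (suc n))               ≈⟨ toℚᵘ-homo-* (a / suc n) (ι (suc n)) ⟩
  toℚᵘ (a / suc n) ℚᵘ.* toℚᵘ (ι (suc n))       ≈⟨ ℚᵘ.*-cong (toℚᵘ-fromℚᵘ (ℚᵘ.mkℚᵘ a n)) (toℚᵘ-⟦⟧ (+ suc n)) ⟩
  ℚᵘ.mkℚᵘ a n ℚᵘ.* ℚᵘ.mkℚᵘ (+ suc n) 0         ≈⟨ ℚᵘ.*≡* (ℤ.*-assoc a (+ suc n) (+ 1)) ⟩
  ℚᵘ.mkℚᵘ a 0                                  ≈⟨ toℚᵘ-⟦⟧ a ⟨
  toℚᵘ ⟦ a ⟧                                   ∎)
  where
  open ℚᵘ.≃-Reasoning
  toℚᵘ-⟦⟧ : ∀ b → toℚᵘ ⟦ b ⟧ ℚᵘ.≃ ℚᵘ.mkℚᵘ b 0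
  toℚᵘ-⟦⟧ b = ℚᵘ.≃-reflexive (cong toℚᵘ (⟦⟧≡int b))

-- Order, reciprocals and powers in the rationals.

*-monoˡ : ∀ {p q r} → 0ℚ ≤ r → p ≤ q → r * p ≤ r * q
*-monoˡ {r = r} 0≤r p≤q = *-monoˡ-≤-nonNeg r {{nonNegative 0≤r}} p≤q

*-monoʳ : ∀ {p q r} → 0ℚ ≤ r → p ≤ q → p * r ≤ q * r
*-monoʳ {r = r} 0≤r p≤q = *-monoʳ-≤-nonNeg r {{nonNegative 0≤r}} p≤q

*-mono : ∀ {p q r s} → 0ℚ ≤ p → 0ℚ ≤ s → p ≤ q → r ≤ s → p * r ≤ q * s
*-mono 0≤p 0≤s p≤q r≤s = ≤-trans (*-monoˡ 0≤p r≤s) (*-monoʳ 0≤s p≤q)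

0≤* : ∀ {p q} → 0ℚ ≤ p → 0ℚ ≤ q → 0ℚ ≤ p * q
0≤* {p} {q} 0≤p 0≤q = subst (_≤ p * q) (*-zeroʳ p) (*-monoˡ 0≤p 0≤q)

*-cancelˡ : ∀ {p q r} → 0ℚ < r → r * p ≤ r * q → p ≤ q
*-cancelˡ {r = r} 0<r = *-cancelˡ-≤-pos r {{positive 0<r}}

*-cancelʳ : ∀ {p q r} → 0ℚ < r → p * r ≤ q * r → p ≤ q
*-cancelʳ {r = r} 0<r = *-cancelʳ-≤-pos r {{positive 0<r}}

reciprocal : ∀ {p} → 0ℚ < p → ∃[ r ] (0ℚ < r × p * r ≡ 1ℚ)
reciprocal {p} 0<p =
  (1/ p) {{nz}} , positive⁻¹ _ {{1/pos⇒pos p {{positive 0<p}}}} , *-inverseʳ p {{nz}}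
  where
  nz : NonZero p
  nz = pos⇒nonZero p {{positive 0<p}}

reciprocal-cancel : ∀ p q {r} → p * r ≡ 1ℚ → p * (q * r) ≡ q
reciprocal-cancel p q {r} pr≡1 = trans (solve 3 (λ p q r → p :* (q :* r) := q :* (p :* r)) refl p q r)
  (trans (cong (q *_) pr≡1) (*-identityʳ q))

0≤^ : ∀ {p} n → 0ℚ ≤ p → 0ℚ ≤ p ^ n
0≤^ zero    0≤p = <⇒≤ (positive⁻¹ 1ℚ)
0≤^ (suc n) 0≤p = 0≤* 0≤p (0≤^ n 0≤p)

0<^ : ∀ {p} n → 0ℚ < p → 0ℚ < p ^ n
0<^ zero    0<p = positive⁻¹ 1ℚ
0<^ {p} (suc n) 0<p = positive⁻¹ _ {{pos*pos⇒pos p {{positive 0<p}} (p ^ n) {{positive (0<^ n 0<p)}}}}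

^-mono : ∀ {p q} n → 0ℚ ≤ p → p ≤ q → p ^ n ≤ q ^ n
^-mono zero    0≤p p≤q = ≤-refl
^-mono (suc n) 0≤p p≤q = *-mono 0≤p (0≤^ n (≤-trans 0≤p p≤q)) p≤q (^-mono n 0≤p p≤q)

^-mono-< : ∀ {p q} n .{{_ : ℕ.NonZero n}} → 0ℚ ≤ p → p < q → p ^ n < q ^ n
^-mono-< {p} {q} (suc n) 0≤p p<q = ≤-<-trans
  (*-monoˡ 0≤p (^-mono n 0≤p (<⇒≤ p<q)))
  (*-monoˡ-<-pos (q ^ n) {{positive (0<^ n (≤-<-trans 0≤p p<q))}} p<q)

-- Takes the place of n-th roots: `p > q` would give `p ^ n > q ^ n`.
^-cancel-≤ : ∀ {p q} n .{{_ : ℕ.NonZero n}} → 0ℚ ≤ q → p ^ n ≤ q ^ n → p ≤ q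
^-cancel-≤ {p} {q} n 0≤q pn≤qn with p ≤? q
... | yes p≤q = p≤q
... | no  p≰q = contradiction pn≤qn (λ le → <-irrefl refl (<-≤-trans (^-mono-< n 0≤q (≰⇒> p≰q)) le))

∣^∣ : ∀ p n → ∣ p ^ n ∣ ≡ ∣ p ∣ ^ n
∣^∣ p zero    = refl
∣^∣ p (suc n) = trans (∣p*q∣≡∣p∣*∣q∣ p (p ^ n)) (cong (∣ p ∣ *_) (∣^∣ p n))

p≤∣p∣ : ∀ p → p ≤ ∣ p ∣
p≤∣p∣ p with ≤-total 0ℚ p
... | inj₁ 0≤p = ≤-reflexive (sym (0≤p⇒∣p∣≡p 0≤p))
... | inj₂ p≤0 = ≤-trans p≤0 (0≤∣p∣ p)

n<2^n : ∀ n → n ℕ.< 2 ℕ.^ n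
n<2^n zero    = ℕ.z<s
n<2^n (suc n) = ℕ.≤-trans (ℕ.+-mono-≤ (ℕ.m^n>0 2 n) (n<2^n n))
  (ℕ.≤-reflexive (cong (2 ℕ.^ n ℕ.+_) (sym (ℕ.+-identityʳ (2 ℕ.^ n)))))

archimedes : ∀ p → ∃[ n ] p ≤ ι n
archimedes p@(mkℚ a d _) = ℤ.∣ a ∣ , ≤-trans (p≤∣p∣ p)
  (subst (∣ p ∣ ≤_) (sym (⟦⟧≡int (+ ℤ.∣ a ∣)))
    (*≤* (ℤ.*-monoˡ-≤-nonNeg (+ ℤ.∣ a ∣) (ℤ.+≤+ (ℕ.s≤s ℕ.z≤n)))))

below-2^ : ∀ p → ∃[ n ] p ≤ ι (2 ℕ.^ n)
below-2^ p = let n , p≤n = archimedes p in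
  n , ≤-trans p≤n (ι-mono (ℕ.<⇒≤ (n<2^n n)))

-- Finite sums and Siegel's lemma.

Σℕ : ℕ → (ℕ → ℕ) → ℕ
Σℕ zero    f = 0
Σℕ (suc n) f = Σℕ n f ℕ.+ f n

Σℤ : ℕ → (ℕ → ℤ) → ℤ
Σℤ zero    f = 0ℤ
Σℤ (suc n) f = Σℤ n f ℤ.+ f n

Σℕ-≤ : ∀ n {f B} → (∀ i → i ℕ.< n → f i ℕ.≤ B) → Σℕ n f ℕ.≤ n ℕ.* B
Σℕ-≤ zero    h = ℕ.z≤n
Σℕ-≤ (suc n) {f} {B} h = ℕ.≤-trans
  (ℕ.+-mono-≤ (Σℕ-≤ n (λ i i<n → h i (ℕ.m<n⇒m<1+n i<n))) (h n ℕ.≤-refl))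
  (ℕ.≤-reflexive (ℕ.+-comm (n ℕ.* B) B))

Σℤ-difference : ∀ n {f : ℕ → ℤ} {g h : ℕ → ℕ} → (∀ i → f i ≡ + g i ℤ.- + h i) →
                Σℤ n f ≡ + Σℕ n g ℤ.- + Σℕ n h
Σℤ-difference zero    eq = refl
Σℤ-difference (suc n) {f} {g} {h} eq = begin
  Σℤ n f ℤ.+ f n
    ≡⟨ cong₂ ℤ._+_ (Σℤ-difference n eq) (eq n) ⟩
  (+ Σℕ n g ℤ.- + Σℕ n h) ℤ.+ (+ g n ℤ.- + h n)
    ≡⟨ interchange (+ Σℕ n g) (+ Σℕ n h) (+ g n) (+ h n) ⟩
  (+ Σℕ n g ℤ.+ + g n) ℤ.- (+ Σℕ n h ℤ.+ + h n)
    ≡⟨ cong₂ ℤ._-_ (ℤ.pos-+ (Σℕ n g) (g n)) (ℤ.pos-+ (Σℕ n h) (h n)) ⟨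
  + Σℕ (suc n) g ℤ.- + Σℕ (suc n) h ∎
  where
  open ≡-Reasoning
  interchange : ∀ a b c d → (a ℤ.- b) ℤ.+ (c ℤ.- d) ≡ (a ℤ.+ c) ℤ.- (b ℤ.+ d)
  interchange = ℤ-Ring.solve-∀

-- Indexing by `ℕ` lets a shifted coordinate `x (i + s)` be written without a proof that its index
-- is in range.
extend : ∀ {A : Set} {n} → A → (Fin n → A) → ℕ → A
extend {n = zero}  z f i       = z
extend {n = suc n} z f zero    = f Fin.zero
extend {n = suc n} z f (suc i) = extend z (f ∘ Fin.suc) i

extend-toℕ : ∀ {A : Set} {n} (z : A) (f : Fin n → A) i → extend z f (toℕ i) ≡ f i
extend-toℕ z f Fin.zero    = refl
extend-toℕ z f (Fin.suc i) = extend-toℕ z (f ∘ Fin.suc) i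

extend-≤ : ∀ {n B} (f : Fin n → ℕ) → (∀ i → f i ℕ.≤ B) → ∀ i → extend 0 f i ℕ.≤ B
extend-≤ {zero}  f h i       = ℕ.z≤n
extend-≤ {suc n} f h zero    = h Fin.zero
extend-≤ {suc n} f h (suc i) = extend-≤ (f ∘ Fin.suc) (h ∘ Fin.suc) i

-- Pointwise agreement has to suffice, since functions are not extensional.
funToFin-cong : ∀ {m n} {f g : Fin m → Fin n} → (∀ i → f i ≡ g i) → Fin.funToFin f ≡ Fin.funToFin g
funToFin-cong {zero}  eq = refl
funToFin-cong {suc m} eq = cong₂ Fin.combine (eq Fin.zero) (funToFin-cong (eq ∘ Fin.suc))

-- Trailing zero coefficients contribute nothing, so the sum may stop after the last nonzero one.
-- That the later coefficients vanish is recorded only through the equality of the two sums.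
leading-term : ∀ n (a x : ℕ → ℤ) → (∀ i → i ℕ.< n → a i ≡ 0ℤ) ⊎
  ∃[ d ] (d ℕ.< n × a d ≢ 0ℤ × Σℤ (suc d) (λ i → a i ℤ.* x i) ≡ Σℤ n (λ i → a i ℤ.* x i))
leading-term zero    a x = inj₁ (λ _ ())
leading-term (suc n) a x with a n ℤ.≟ 0ℤ
... | no  aₙ≢0 = inj₂ (n , ℕ.≤-refl , aₙ≢0 , refl)
... | yes aₙ≡0 with leading-term n a x
...   | inj₁ h = inj₁ λ i i<1+n → case-≤ i (ℕ.m≤n⇒m<n∨m≡n (ℕ.s≤s⁻¹ i<1+n))
  where
  case-≤ : ∀ i → i ℕ.< n ⊎ i ≡ n → a i ≡ 0ℤ
  case-≤ i (inj₁ i<n)  = h i i<n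
  case-≤ i (inj₂ refl) = aₙ≡0
...   | inj₂ (d , d<n , a≢0 , eq) = inj₂ (d , ℕ.m<n⇒m<1+n d<n , a≢0 ,
  trans eq (sym (trans
    (cong (λ t → Σℤ n (λ i → a i ℤ.* x i) ℤ.+ t ℤ.* x n) aₙ≡0)
    (ℤ.+-identityʳ (Σℤ n (λ i → a i ℤ.* x i))))))

-- The sign of `0` is `1ℤ`, so that multiplying by a sign stays injective where a coordinate
-- vanishes; otherwise distinct digit vectors could produce `a = 0`.
sgn : ℤ → ℤ
sgn (+ _)    = 1ℤ
sgn -[1+ _ ] = -1ℤ

sgn-* : ∀ a → sgn a ℤ.* a ≡ + ℤ.∣ a ∣
sgn-* (+ n)    = ℤ.*-identityˡ (+ n)
sgn-* -[1+ n ] = ℤ.-1*i≡-i -[1+ n ]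

∣sgn-*∣ : ∀ a b → ℤ.∣ sgn a ℤ.* b ∣ ≡ ℤ.∣ b ∣
∣sgn-*∣ (+ n)    b = cong ℤ.∣_∣ (ℤ.*-identityˡ b)
∣sgn-*∣ -[1+ n ] b = trans (cong ℤ.∣_∣ (ℤ.-1*i≡-i b)) (ℤ.∣-i∣≡∣i∣ b)

-- Pigeonhole on the (K+1)^n coefficient vectors in [0, K]^n; replacing x by |x|
-- keeps all the values Σ vᵢ |xᵢ| natural, and the signs are put back into a.
siegel : ∀ n K S (x : ℕ → ℤ) → (∀ i → i ℕ.< n → ℤ.∣ x i ∣ ℕ.≤ S) →
  suc (n ℕ.* (K ℕ.* S)) ℕ.< suc K ℕ.^ n →
  ∃[ a ] ((∀ i → ℤ.∣ a i ∣ ℕ.≤ K) × ¬ (∀ i → i ℕ.< n → a i ≡ 0ℤ) ×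
          Σℤ n (λ i → a i ℤ.* x i) ≡ 0ℤ)
siegel n K S x x≤S small = a , a≤K , a≢0 , relation
  where
  digits : Fin (suc K ℕ.^ n) → ℕ → ℕ
  digits j = extend 0 (toℕ ∘ Fin.finToFun {suc K} {n} j)

  digits≤K : ∀ j i → digits j i ℕ.≤ K
  digits≤K j = extend-≤ _ (λ i → ℕ.s≤s⁻¹ (Fin.toℕ<n (Fin.finToFun {suc K} {n} j i)))

  digits-injective : ∀ j l → (∀ i → i ℕ.< n → digits j i ≡ digits l i) → j ≡ l
  digits-injective j l eq = begin
    j                                            ≡⟨ Fin.funToFin-finToFin {n} {suc K} j ⟨
    Fin.funToFin (Fin.finToFun {suc K} {n} j)    ≡⟨ funToFin-cong (λ i → Fin.toℕ-injective (same i)) ⟩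
    Fin.funToFin (Fin.finToFun {suc K} {n} l)    ≡⟨ Fin.funToFin-finToFin {n} {suc K} l ⟩
    l                                            ∎
    where
    open ≡-Reasoning
    same : ∀ i → toℕ (Fin.finToFun {suc K} {n} j i) ≡ toℕ (Fin.finToFun {suc K} {n} l i)
    same i = trans (sym (extend-toℕ 0 _ i)) (trans (eq (toℕ i) (Fin.toℕ<n i)) (extend-toℕ 0 _ i))

  value : Fin (suc K ℕ.^ n) → ℕ
  value j = Σℕ n (λ i → digits j i ℕ.* ℤ.∣ x i ∣)

  value< : ∀ j → value j ℕ.< suc (n ℕ.* (K ℕ.* S))
  value< j = ℕ.s≤s (Σℕ-≤ n (λ i i<n → ℕ.*-mono-≤ (digits≤K j i) (x≤S i i<n)))

  -- The values lie in `{0, …, n K S}`, which makes `n K S + 1` pigeonholes; hence the successor in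
  -- the hypothesis.
  collision = Fin.pigeonhole small (λ j → Fin.fromℕ< (value< j))

  j l : Fin (suc K ℕ.^ n)
  j = proj₁ collision
  l = proj₁ (proj₂ collision)

  values-agree : value j ≡ value l
  values-agree = Fin.fromℕ<-injective _ _ (value< j) (value< l) (proj₂ (proj₂ (proj₂ collision)))

  a : ℕ → ℤ
  a i = sgn (x i) ℤ.* (digits j i ⊖ digits l i)

  a≤K : ∀ i → ℤ.∣ a i ∣ ℕ.≤ K
  a≤K i = subst (ℕ._≤ K) (sym (∣sgn-*∣ (x i) (digits j i ⊖ digits l i)))
    (ℕ.≤-trans (ℤ.∣m⊝n∣≤m⊔n (digits j i) (digits l i))
      (ℕ.⊔-lub (digits≤K j i) (digits≤K l i)))

  a≢0 : ¬ (∀ i → i ℕ.< n → a i ≡ 0ℤ)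
  a≢0 h = Fin.<⇒≢ (proj₁ (proj₂ (proj₂ collision))) (digits-injective j l (λ i i<n →
    ℤ.+-injective (ℤ.i-j≡0⇒i≡j _ _ (trans (ℤ.m-n≡m⊖n (digits j i) (digits l i))
      (ℤ.∣i∣≡0⇒i≡0 (trans (sym (∣sgn-*∣ (x i) _)) (cong ℤ.∣_∣ (h i i<n))))))))

  term : ∀ i → a i ℤ.* x i ≡ + (digits j i ℕ.* ℤ.∣ x i ∣) ℤ.- + (digits l i ℕ.* ℤ.∣ x i ∣)
  term i = begin
    sgn (x i) ℤ.* (digits j i ⊖ digits l i) ℤ.* x i
      ≡⟨ cong (λ t → sgn (x i) ℤ.* t ℤ.* x i) (ℤ.m-n≡m⊖n (digits j i) (digits l i)) ⟨
    sgn (x i) ℤ.* (+ digits j i ℤ.- + digits l i) ℤ.* x i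
      ≡⟨ rearrange (sgn (x i)) (+ digits j i) (+ digits l i) (x i) ⟩
    + digits j i ℤ.* (sgn (x i) ℤ.* x i) ℤ.- + digits l i ℤ.* (sgn (x i) ℤ.* x i)
      ≡⟨ cong (λ t → + digits j i ℤ.* t ℤ.- + digits l i ℤ.* t) (sgn-* (x i)) ⟩
    + digits j i ℤ.* + ℤ.∣ x i ∣ ℤ.- + digits l i ℤ.* + ℤ.∣ x i ∣
      ≡⟨ cong₂ ℤ._-_ (ℤ.pos-* (digits j i) ℤ.∣ x i ∣) (ℤ.pos-* (digits l i) ℤ.∣ x i ∣) ⟨
    + (digits j i ℕ.* ℤ.∣ x i ∣) ℤ.- + (digits l i ℕ.* ℤ.∣ x i ∣) ∎
    where
    open ≡-Reasoning
    rearrange : ∀ s v w y → s ℤ.* (v ℤ.- w) ℤ.* y ≡ v ℤ.* (s ℤ.* y) ℤ.- w ℤ.* (s ℤ.* y)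
    rearrange = ℤ-Ring.solve-∀

  relation : Σℤ n (λ i → a i ℤ.* x i) ≡ 0ℤ
  relation = trans (Σℤ-difference n term)
    (trans (cong (λ v → + v ℤ.- + value l) values-agree) (ℤ.+-inverseʳ (+ value l)))

-- Prolonging an approximation vector by one coordinate.

ι-suc : ∀ n → ι (suc n) ≡ ι n + 1ℚ
ι-suc n = trans (cong ι (ℕ.+-comm 1 n)) (trans (ι-+ n 1) (cong (λ o → ι n + o) (⟦⟧≡/1 1ℤ)))

error : (ℕ → ℤ) → ℚ → ℕ → ℚ
error x z i = ∣ ⟦ x 0 ⟧ * z ^ i - ⟦ x i ⟧ ∣

error-zero : ∀ x z → error x z 0 ≡ 0ℚ
error-zero x z = cong ∣_∣ (trans (cong (_- ⟦ x 0 ⟧) (*-identityʳ ⟦ x 0 ⟧)) (+-inverseʳ ⟦ x 0 ⟧))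

-- For z close to ξ the number z^s Σ aᵢ zⁱ is nearly 0; this dictates the next coordinate
-- of the multiple a_d x.
module _ (k d s K : ℕ) (d≤k : d ℕ.≤ k) (d+s≡1+k : d ℕ.+ s ≡ suc k)
         (a x : ℕ → ℤ) (a≤K : ∀ i → ℤ.∣ a i ∣ ℕ.≤ K)
         (relation : Σℤ (suc d) (λ i → a i ℤ.* x i) ≡ 0ℤ) where

  private

    shifted : ℤ
    shifted = Σℤ d (λ i → a i ℤ.* x (i ℕ.+ s))

  prolongation : ℕ → ℤ
  prolongation j with j ℕ.≤? k
  ... | yes _ = a d ℤ.* x j
  ... | no  _ = ℤ.- shifted

  private

    ∣a∣≤K : ∀ i → ∣ ⟦ a i ⟧ ∣ ≤ ι K
    ∣a∣≤K i = subst (_≤ ι K) (sym (⟦⟧-∣∣ (a i))) (ι-mono (a≤K i))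

    -- Here `t` stands for `z ^ s`: multiplication by it shifts the coordinates by `s`, up to `ζ` in
    -- each, and every term adds at most `ι K * ζ`.
    shifted-sum : ∀ n t {ζ} → 0ℚ ≤ ζ → (∀ i → i ℕ.< n → ∣ ⟦ x (i ℕ.+ s) ⟧ - t * ⟦ x i ⟧ ∣ ≤ ζ) →
      ∣ ⟦ Σℤ n (λ i → a i ℤ.* x (i ℕ.+ s)) ⟧ - t * ⟦ Σℤ n (λ i → a i ℤ.* x i) ⟧ ∣ ≤ ι n * (ι K * ζ)
    shifted-sum zero t {ζ} 0≤ζ h = ≤-reflexive (begin
      ∣ ⟦ 0ℤ ⟧ - t * ⟦ 0ℤ ⟧ ∣   ≡⟨ cong (λ o → ∣ o - t * o ∣) (⟦⟧≡/1 0ℤ) ⟩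
      ∣ 0ℚ - t * 0ℚ ∣           ≡⟨ cong (λ o → ∣ 0ℚ - o ∣) (*-zeroʳ t) ⟩
      0ℚ                        ≡⟨ *-zeroˡ (ι K * ζ) ⟨
      0ℚ * (ι K * ζ)            ≡⟨ cong (_* (ι K * ζ)) (⟦⟧≡/1 0ℤ) ⟨
      ι 0 * (ι K * ζ)           ∎)
      where open ≡-Reasoning
    shifted-sum (suc n) t {ζ} 0≤ζ h = begin
      ∣ ⟦ σ′ ℤ.+ a n ℤ.* x (n ℕ.+ s) ⟧ - t * ⟦ σ ℤ.+ a n ℤ.* x n ⟧ ∣
        ≡⟨ cong₂ (λ p q → ∣ p - t * q ∣) (split σ′ (a n) (x (n ℕ.+ s))) (split σ (a n) (x n)) ⟩
      ∣ (⟦ σ′ ⟧ + ⟦ a n ⟧ * ⟦ x (n ℕ.+ s) ⟧) - t * (⟦ σ ⟧ + ⟦ a n ⟧ * ⟦ x n ⟧) ∣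
        ≡⟨ cong ∣_∣ (solve 6 (λ p α u v q w → (p :+ α :* u) :- v :* (q :+ α :* w)
             := (p :- v :* q) :+ α :* (u :- v :* w)) refl ⟦ σ′ ⟧ ⟦ a n ⟧ ⟦ x (n ℕ.+ s) ⟧ t ⟦ σ ⟧ ⟦ x n ⟧) ⟩
      ∣ (⟦ σ′ ⟧ - t * ⟦ σ ⟧) + ⟦ a n ⟧ * (⟦ x (n ℕ.+ s) ⟧ - t * ⟦ x n ⟧) ∣
        ≤⟨ ∣p+q∣≤∣p∣+∣q∣ (⟦ σ′ ⟧ - t * ⟦ σ ⟧) (⟦ a n ⟧ * (⟦ x (n ℕ.+ s) ⟧ - t * ⟦ x n ⟧)) ⟩
      ∣ ⟦ σ′ ⟧ - t * ⟦ σ ⟧ ∣ + ∣ ⟦ a n ⟧ * (⟦ x (n ℕ.+ s) ⟧ - t * ⟦ x n ⟧) ∣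
        ≡⟨ cong (λ o → ∣ ⟦ σ′ ⟧ - t * ⟦ σ ⟧ ∣ + o) (∣p*q∣≡∣p∣*∣q∣ ⟦ a n ⟧ (⟦ x (n ℕ.+ s) ⟧ - t * ⟦ x n ⟧)) ⟩
      ∣ ⟦ σ′ ⟧ - t * ⟦ σ ⟧ ∣ + ∣ ⟦ a n ⟧ ∣ * ∣ ⟦ x (n ℕ.+ s) ⟧ - t * ⟦ x n ⟧ ∣
        ≤⟨ +-mono-≤ (shifted-sum n t 0≤ζ (λ i i<n → h i (ℕ.m<n⇒m<1+n i<n)))
             (*-mono (0≤∣p∣ ⟦ a n ⟧) 0≤ζ (∣a∣≤K n) (h n ℕ.≤-refl)) ⟩
      ι n * (ι K * ζ) + ι K * ζ
        ≡⟨ solve 2 (λ p q → p :* q :+ q := (p :+ con 1ℚ) :* q) refl (ι n) (ι K * ζ) ⟩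
      (ι n + 1ℚ) * (ι K * ζ)
        ≡⟨ cong (_* (ι K * ζ)) (ι-suc n) ⟨
      ι (suc n) * (ι K * ζ) ∎
      where
      open ≤-Reasoning
      σ σ′ : ℤ
      σ  = Σℤ n (λ i → a i ℤ.* x i)
      σ′ = Σℤ n (λ i → a i ℤ.* x (i ℕ.+ s))
      split : ∀ p q r → ⟦ p ℤ.+ q ℤ.* r ⟧ ≡ ⟦ p ⟧ + ⟦ q ⟧ * ⟦ r ⟧
      split p q r = trans (⟦⟧-+ p (q ℤ.* r)) (cong (λ o → ⟦ p ⟧ + o) (⟦⟧-* q r))

    module _ (z : ℚ) (G : ℕ) {η : ℚ} (0≤η : 0ℚ ≤ η)
             (z^s≤G : ∣ z ^ s ∣ ≤ ι G) (close : ∀ i → i ℕ.≤ k → error x z i ≤ η) where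

      -- The cost of replacing `x (i + s)` by `z ^ s * x i`: `ι G * η` from the error at `i`,
      -- multiplied by `z ^ s`, and `η` from the error at `i + s`.
      ζ : ℚ
      ζ = (1ℚ + ι G) * η

      η≤ζ : η ≤ ζ
      η≤ζ = subst (_≤ ζ) (*-identityˡ η) (*-monoʳ 0≤η
        (subst (_≤ 1ℚ + ι G) (+-identityʳ 1ℚ) (+-monoʳ-≤ 1ℚ (0≤ι G))))

      Gη≤ζ : ι G * η ≤ ζ
      Gη≤ζ = *-monoʳ 0≤η (subst (_≤ 1ℚ + ι G) (+-identityˡ (ι G))
        (+-monoˡ-≤ (ι G) (<⇒≤ (positive⁻¹ 1ℚ))))

      0≤ζ : 0ℚ ≤ ζ
      0≤ζ = ≤-trans 0≤η η≤ζ

      shift-close : ∀ i → i ℕ.< d → ∣ ⟦ x (i ℕ.+ s) ⟧ - z ^ s * ⟦ x i ⟧ ∣ ≤ ζ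
      shift-close i i<d = begin
        ∣ ⟦ x (i ℕ.+ s) ⟧ - z ^ s * ⟦ x i ⟧ ∣
          -- The product `x 0 * z ^ (i + s)` is inserted; it cancels between the two errors.
          ≡⟨ cong ∣_∣ (trans
               (solve 5 (λ u v w o r → u :- v :* w := v :* (o :* r :- w) :- (o :* (r :* v) :- u)) refl
                 ⟦ x (i ℕ.+ s) ⟧ (z ^ s) ⟦ x i ⟧ ⟦ x 0 ⟧ (z ^ i))
               (cong (λ r → z ^ s * (⟦ x 0 ⟧ * z ^ i - ⟦ x i ⟧) - (⟦ x 0 ⟧ * r - ⟦ x (i ℕ.+ s) ⟧))
                 (sym (^-homo-* z i s)))) ⟩
        ∣ z ^ s * (⟦ x 0 ⟧ * z ^ i - ⟦ x i ⟧) - (⟦ x 0 ⟧ * z ^ (i ℕ.+ s) - ⟦ x (i ℕ.+ s) ⟧) ∣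
          ≤⟨ ∣p-q∣≤∣p∣+∣q∣ (z ^ s * (⟦ x 0 ⟧ * z ^ i - ⟦ x i ⟧)) _ ⟩
        ∣ z ^ s * (⟦ x 0 ⟧ * z ^ i - ⟦ x i ⟧) ∣ + error x z (i ℕ.+ s)
          ≡⟨ cong (_+ error x z (i ℕ.+ s)) (∣p*q∣≡∣p∣*∣q∣ (z ^ s) _) ⟩
        ∣ z ^ s ∣ * error x z i + error x z (i ℕ.+ s)
          ≤⟨ +-mono-≤ (*-mono (0≤∣p∣ (z ^ s)) 0≤η z^s≤G (close i i≤k)) (close (i ℕ.+ s) i+s≤k) ⟩
        ι G * η + η
          ≡⟨ solve 2 (λ p q → p :* q :+ q := (con 1ℚ :+ p) :* q) refl (ι G) η ⟩
        ζ ∎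
        where
        open ≤-Reasoning
        i≤k : i ℕ.≤ k
        i≤k = ℕ.≤-trans (ℕ.<⇒≤ i<d) d≤k
        i+s≤k : i ℕ.+ s ℕ.≤ k
        i+s≤k = ℕ.s≤s⁻¹ (subst (i ℕ.+ s ℕ.<_) d+s≡1+k (ℕ.+-monoˡ-< s i<d))

      multiple-close : ∀ j → j ℕ.≤ k → ∣ ⟦ a d ℤ.* x 0 ⟧ * z ^ j - ⟦ a d ℤ.* x j ⟧ ∣ ≤ ι K * ζ
      multiple-close j j≤k = begin
        ∣ ⟦ a d ℤ.* x 0 ⟧ * z ^ j - ⟦ a d ℤ.* x j ⟧ ∣
          ≡⟨ cong₂ (λ p q → ∣ p * z ^ j - q ∣) (⟦⟧-* (a d) (x 0)) (⟦⟧-* (a d) (x j)) ⟩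
        ∣ ⟦ a d ⟧ * ⟦ x 0 ⟧ * z ^ j - ⟦ a d ⟧ * ⟦ x j ⟧ ∣
          ≡⟨ cong ∣_∣ (solve 4 (λ α o r w → α :* o :* r :- α :* w := α :* (o :* r :- w)) refl
               ⟦ a d ⟧ ⟦ x 0 ⟧ (z ^ j) ⟦ x j ⟧) ⟩
        ∣ ⟦ a d ⟧ * (⟦ x 0 ⟧ * z ^ j - ⟦ x j ⟧) ∣
          ≡⟨ ∣p*q∣≡∣p∣*∣q∣ ⟦ a d ⟧ _ ⟩
        ∣ ⟦ a d ⟧ ∣ * error x z j
          ≤⟨ *-mono (0≤∣p∣ ⟦ a d ⟧) 0≤ζ (∣a∣≤K d) (≤-trans (close j j≤k) η≤ζ) ⟩
        ι K * ζ ∎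
        where open ≤-Reasoning

      relation-at-z : z ^ s * (⟦ Σℤ d (λ i → a i ℤ.* x i) ⟧ + ⟦ a d ⟧ * ⟦ x d ⟧) ≡ 0ℚ
      relation-at-z = begin
        z ^ s * (⟦ Σℤ d (λ i → a i ℤ.* x i) ⟧ + ⟦ a d ⟧ * ⟦ x d ⟧)
          ≡⟨ cong (λ p → z ^ s * (⟦ Σℤ d (λ i → a i ℤ.* x i) ⟧ + p)) (⟦⟧-* (a d) (x d)) ⟨
        z ^ s * (⟦ Σℤ d (λ i → a i ℤ.* x i) ⟧ + ⟦ a d ℤ.* x d ⟧)
          ≡⟨ cong (z ^ s *_) (⟦⟧-+ _ (a d ℤ.* x d)) ⟨
        z ^ s * ⟦ Σℤ (suc d) (λ i → a i ℤ.* x i) ⟧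
          ≡⟨ cong (λ p → z ^ s * ⟦ p ⟧) relation ⟩
        z ^ s * ⟦ 0ℤ ⟧
          ≡⟨ cong (z ^ s *_) (⟦⟧≡/1 0ℤ) ⟩
        z ^ s * 0ℚ
          ≡⟨ *-zeroʳ (z ^ s) ⟩
        0ℚ ∎
        where open ≡-Reasoning

      next-close : ∣ ⟦ a d ℤ.* x 0 ⟧ * z ^ suc k - ⟦ ℤ.- shifted ⟧ ∣ ≤ ι (suc d) * (ι K * ζ)
      next-close = begin
        ∣ ⟦ a d ℤ.* x 0 ⟧ * z ^ suc k - ⟦ ℤ.- shifted ⟧ ∣
          ≡⟨ cong₂ (λ p q → ∣ p * z ^ suc k - q ∣) (⟦⟧-* (a d) (x 0)) (⟦⟧-neg shifted) ⟩
        ∣ ⟦ a d ⟧ * ⟦ x 0 ⟧ * z ^ suc k - (- ⟦ shifted ⟧) ∣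
          ≡⟨ cong (λ r → ∣ ⟦ a d ⟧ * ⟦ x 0 ⟧ * r - (- ⟦ shifted ⟧) ∣)
               (trans (cong (z ^_) (sym d+s≡1+k)) (^-homo-* z d s)) ⟩
        ∣ ⟦ a d ⟧ * ⟦ x 0 ⟧ * (z ^ d * z ^ s) - (- ⟦ shifted ⟧) ∣
          -- Three pieces: the error of the top term, the error of the shifted sum, and `z ^ s`
          -- times the relation, which vanishes exactly. The first counts once and the second `d`
          -- times, giving the factor `suc d`.
          ≡⟨ cong ∣_∣ (solve 7 (λ α o r t σ′ σ w → α :* o :* (r :* t) :- (:- σ′)
               := (α :* (t :* (o :* r :- w)) :+ (σ′ :- t :* σ)) :+ t :* (σ :+ α :* w)) refl
               ⟦ a d ⟧ ⟦ x 0 ⟧ (z ^ d) (z ^ s) ⟦ shifted ⟧ ⟦ σ ⟧ ⟦ x d ⟧) ⟩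
        ∣ (⟦ a d ⟧ * (z ^ s * (⟦ x 0 ⟧ * z ^ d - ⟦ x d ⟧)) + (⟦ shifted ⟧ - z ^ s * ⟦ σ ⟧))
            + z ^ s * (⟦ σ ⟧ + ⟦ a d ⟧ * ⟦ x d ⟧) ∣
          ≡⟨ cong ∣_∣ (trans (cong (λ o → p₁ + p₂ + o) relation-at-z) (+-identityʳ (p₁ + p₂))) ⟩
        ∣ p₁ + p₂ ∣
          ≤⟨ ∣p+q∣≤∣p∣+∣q∣ p₁ p₂ ⟩
        ∣ p₁ ∣ + ∣ p₂ ∣
          ≤⟨ +-mono-≤ p₁-bound (shifted-sum d (z ^ s) 0≤ζ shift-close) ⟩
        ι K * ζ + ι d * (ι K * ζ)
          ≡⟨ solve 2 (λ p q → q :+ p :* q := (p :+ con 1ℚ) :* q) refl (ι d) (ι K * ζ) ⟩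
        (ι d + 1ℚ) * (ι K * ζ)
          ≡⟨ cong (_* (ι K * ζ)) (ι-suc d) ⟨
        ι (suc d) * (ι K * ζ) ∎
        where
        open ≤-Reasoning
        σ : ℤ
        σ = Σℤ d (λ i → a i ℤ.* x i)
        p₁ p₂ : ℚ
        p₁ = ⟦ a d ⟧ * (z ^ s * (⟦ x 0 ⟧ * z ^ d - ⟦ x d ⟧))
        p₂ = ⟦ shifted ⟧ - z ^ s * ⟦ σ ⟧
        p₁-bound : ∣ p₁ ∣ ≤ ι K * ζ
        p₁-bound = begin
          ∣ p₁ ∣
            ≡⟨ trans (∣p*q∣≡∣p∣*∣q∣ ⟦ a d ⟧ _) (cong (∣ ⟦ a d ⟧ ∣ *_) (∣p*q∣≡∣p∣*∣q∣ (z ^ s) _)) ⟩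
          ∣ ⟦ a d ⟧ ∣ * (∣ z ^ s ∣ * error x z d)
            ≤⟨ *-mono (0≤∣p∣ ⟦ a d ⟧) 0≤ζ (∣a∣≤K d)
                 (≤-trans (*-mono (0≤∣p∣ (z ^ s)) 0≤η z^s≤G (close d d≤k)) Gη≤ζ) ⟩
          ι K * ζ ∎

  prolongation-close : ∀ z G {η} → 0ℚ ≤ η → ∣ z ^ s ∣ ≤ ι G → (∀ i → i ℕ.≤ k → error x z i ≤ η) →
    ∀ j → j ℕ.≤ suc k → error prolongation z j ≤ ι (suc k) * (ι K * ((1ℚ + ι G) * η))
  prolongation-close z G {η} 0≤η z^s≤G close j j≤1+k with j ℕ.≤? k
  ... | yes j≤k = ≤-trans (multiple-close z G 0≤η z^s≤G close j j≤k)
    (subst (_≤ ι (suc k) * T) (*-identityˡ T) (*-monoʳ 0≤T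
      (subst (_≤ ι (suc k)) (⟦⟧≡/1 1ℤ) (ι-mono (ℕ.s≤s ℕ.z≤n)))))
    where
    T : ℚ
    T = ι K * ((1ℚ + ι G) * η)
    0≤T : 0ℚ ≤ T
    0≤T = 0≤* (0≤ι K) (0≤ζ z G 0≤η z^s≤G close)
  ... | no j≰k with refl ← ℕ.≤-antisym j≤1+k (ℕ.≰⇒> j≰k) =
    ≤-trans (next-close z G 0≤η z^s≤G close)
      (*-monoʳ (0≤* (0≤ι K) (0≤ζ z G 0≤η z^s≤G close)) (ι-mono (ℕ.s≤s d≤k)))

-- Approximation along powers of two, and the passage from k to k + 1.

Eventually : (ℕ → Set) → Set
Eventually P = ∃[ N ] (∀ l → N ℕ.≤ l → P l)

eventually-map₂ : ∀ {P Q R : ℕ → Set} → (∀ l → P l → Q l → R l) →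
                  Eventually P → Eventually Q → Eventually R
eventually-map₂ f (M , p) (N , q) = M ℕ.⊔ N , λ l h →
  f l (p l (ℕ.m⊔n≤o⇒m≤o M N h)) (q l (ℕ.m⊔n≤o⇒n≤o M N h))

-- For b > 0 and unboundedly many m, the integer vector x solves the system with
-- X = 2^(bm) and X^(-λ) = 2^((a-c)m), that is λ = (c - a)/b; the inequalities are those
-- between the rationals representing the two sides.
Approximable : (n : ℕ) (ξ : ℝ) (a c b : ℕ) → Set
Approximable n ξ a c b = ∀ M → ∃[ m ] (M ℕ.≤ m × ∃[ x ] (x 0 ≢ 0ℤ ×
  ℤ.∣ x 0 ∣ ℕ.≤ 2 ℕ.^ (b ℕ.* m) ×
  Eventually (λ l → ∀ i → i ℕ.≤ n →
    ι (2 ℕ.^ (c ℕ.* m)) * error x (seq ξ l) i ≤ ι (2 ℕ.^ (a ℕ.* m)))))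

eventually-bounded : ∀ ξ → ∃[ g ] Eventually (λ l → ∣ seq ξ l ∣ ≤ ι (2 ℕ.^ g))
eventually-bounded ξ with cauchy ξ 1ℚ (positive⁻¹ 1ℚ)
... | N , h = let g , B≤2^g = below-2^ (1ℚ + ∣ seq ξ N ∣) in g , N , λ l N≤l → begin
  ∣ seq ξ l ∣
    ≡⟨ cong ∣_∣ (solve 2 (λ p q → p := (p :- q) :+ q) refl (seq ξ l) (seq ξ N)) ⟩
  ∣ (seq ξ l - seq ξ N) + seq ξ N ∣
    ≤⟨ ∣p+q∣≤∣p∣+∣q∣ (seq ξ l - seq ξ N) (seq ξ N) ⟩
  ∣ seq ξ l - seq ξ N ∣ + ∣ seq ξ N ∣
    ≤⟨ +-monoˡ-≤ ∣ seq ξ N ∣ (h l N N≤l ℕ.≤-refl) ⟩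
  1ℚ + ∣ seq ξ N ∣
    ≤⟨ B≤2^g ⟩
  ι (2 ℕ.^ g) ∎
  where open ≤-Reasoning

∣^∣-≤-2^ : ∀ z g i n → i ℕ.≤ n → ∣ z ∣ ≤ ι (2 ℕ.^ g) → ∣ z ^ i ∣ ≤ ι (2 ℕ.^ (g ℕ.* n))
∣^∣-≤-2^ z g i n i≤n z≤ = begin
  ∣ z ^ i ∣                 ≡⟨ ∣^∣ z i ⟩
  ∣ z ∣ ^ i                 ≤⟨ ^-mono i (0≤∣p∣ z) z≤ ⟩
  ι (2 ℕ.^ g) ^ i           ≡⟨ ι-^ (2 ℕ.^ g) i ⟨
  ι ((2 ℕ.^ g) ℕ.^ i)       ≡⟨ cong ι (ℕ.^-*-assoc 2 g i) ⟩
  ι (2 ℕ.^ (g ℕ.* i))       ≤⟨ ι-mono (ℕ.^-monoʳ-≤ 2 (ℕ.*-monoʳ-≤ g i≤n)) ⟩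
  ι (2 ℕ.^ (g ℕ.* n))       ∎
  where open ≤-Reasoning

-- In `(K + 1)^(k + 1) = (K + 1)^k + K (K +
-- 1)^k` the first summand exceeds `1` and the second covers `K n S`.
siegel-condition : ∀ n k K S → n ℕ.* S ℕ.≤ suc K ℕ.^ k → 1 ℕ.< suc K ℕ.^ k →
                   suc (n ℕ.* (K ℕ.* S)) ℕ.< suc K ℕ.^ suc k
siegel-condition n k K S nS≤ 1< = begin-strict
  suc (n ℕ.* (K ℕ.* S))                 ≡⟨ cong suc (swap n K S) ⟩
  1 ℕ.+ K ℕ.* (n ℕ.* S)                 <⟨ ℕ.+-mono-<-≤ 1< (ℕ.*-monoʳ-≤ K nS≤) ⟩
  suc K ℕ.^ k ℕ.+ K ℕ.* suc K ℕ.^ k     ∎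
  where
  open ℕ.≤-Reasoning
  swap : ∀ a b c → a ℕ.* (b ℕ.* c) ≡ b ℕ.* (a ℕ.* c)
  swap = ℕ-Ring.solve-∀

module _ (ξ : ℝ) (k b c : ℕ) .{{_ : ℕ.NonZero k}} .{{_ : ℕ.NonZero b}} where

  private

    g : ℕ
    g = proj₁ (eventually-bounded ξ)

    -- Absorbs the factors k + 1, 2 and |ξ|^(k+1) that do not depend on m.
    h : ℕ
    h = suc k ℕ.+ suc (g ℕ.* suc k)

    G : ℕ
    G = 2 ℕ.^ (g ℕ.* suc k)

    2^-* : ∀ p q → 2 ℕ.^ p ℕ.* 2 ℕ.^ q ≡ 2 ℕ.^ (p ℕ.+ q)
    2^-* p q = sym (ℕ.^-distribˡ-+-* 2 p q)

    1+G≤ : 1 ℕ.+ G ℕ.≤ 2 ℕ.^ suc (g ℕ.* suc k)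
    1+G≤ = ℕ.≤-trans (ℕ.+-monoˡ-≤ G (ℕ.m^n>0 2 (g ℕ.* suc k)))
      (ℕ.≤-reflexive (cong (G ℕ.+_) (sym (ℕ.+-identityʳ G))))

    module _ (m : ℕ) where

      -- With `X = 2^(k b m)`, `Q` is `X^(1/k)` times `2^h`, and `K` is one less so that the number
      -- `K + 1` of digits is a power of two. `S` comes from `∣xᵢ∣ ≤ X G + 1 ≤ 2 X G`.
      Q K S : ℕ
      Q = 2 ℕ.^ (b ℕ.* m ℕ.+ h)
      K = ℕ.pred Q
      S = 2 ℕ.^ (suc (g ℕ.* suc k) ℕ.+ k ℕ.* b ℕ.* m)

      suc-K : suc K ≡ Q
      suc-K = ℕ.suc-pred Q {{ℕ.m^n≢0 2 (b ℕ.* m ℕ.+ h)}}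

      coordinates≤S : ∀ x z {η} → ℤ.∣ x 0 ∣ ℕ.≤ 2 ℕ.^ (k ℕ.* b ℕ.* m) → ∣ z ∣ ≤ ι (2 ℕ.^ g) →
        η ≤ 1ℚ → ∀ i → i ℕ.≤ k → error x z i ≤ η → ℤ.∣ x i ∣ ℕ.≤ S
      coordinates≤S x z {η} x₀≤ z≤ η≤1 i i≤k close = ι-cancel-≤ (begin
        ι ℤ.∣ x i ∣
          ≡⟨ ⟦⟧-∣∣ (x i) ⟨
        ∣ ⟦ x i ⟧ ∣
          ≡⟨ cong ∣_∣ (solve 2 (λ p q → q := p :- (p :- q)) refl (⟦ x 0 ⟧ * z ^ i) ⟦ x i ⟧) ⟩
        ∣ ⟦ x 0 ⟧ * z ^ i - (⟦ x 0 ⟧ * z ^ i - ⟦ x i ⟧) ∣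
          ≤⟨ ∣p-q∣≤∣p∣+∣q∣ (⟦ x 0 ⟧ * z ^ i) (⟦ x 0 ⟧ * z ^ i - ⟦ x i ⟧) ⟩
        ∣ ⟦ x 0 ⟧ * z ^ i ∣ + error x z i
          ≡⟨ cong (_+ error x z i) (trans (∣p*q∣≡∣p∣*∣q∣ ⟦ x 0 ⟧ (z ^ i))
               (cong (_* ∣ z ^ i ∣) (⟦⟧-∣∣ (x 0)))) ⟩
        ι ℤ.∣ x 0 ∣ * ∣ z ^ i ∣ + error x z i
          ≤⟨ +-mono-≤ (*-mono (0≤ι ℤ.∣ x 0 ∣) (0≤ι G) (ι-mono x₀≤)
               (∣^∣-≤-2^ z g i (suc k) (ℕ.m≤n⇒m≤1+n i≤k) z≤)) (≤-trans close η≤1) ⟩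
        ι X * ι G + 1ℚ
          ≡⟨ cong₂ _+_ (ι-* X G) (⟦⟧≡/1 1ℤ) ⟨
        ι (X ℕ.* G) + ι 1
          ≡⟨ ι-+ (X ℕ.* G) 1 ⟨
        ι (X ℕ.* G ℕ.+ 1)
          ≤⟨ ι-mono XG+1≤S ⟩
        ι S ∎)
        where
        open ≤-Reasoning
        X : ℕ
        X = 2 ℕ.^ (k ℕ.* b ℕ.* m)
        XG+1≤S : X ℕ.* G ℕ.+ 1 ℕ.≤ S
        XG+1≤S = ℕ.≤-trans (ℕ.+-monoʳ-≤ (X ℕ.* G)
            (ℕ.*-mono-≤ (ℕ.m^n>0 2 (k ℕ.* b ℕ.* m)) (ℕ.m^n>0 2 (g ℕ.* suc k))))
          (ℕ.≤-reflexive (trans (double X G) (2^-* (suc (g ℕ.* suc k)) (k ℕ.* b ℕ.* m))))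
          where
          double : ∀ p q → p ℕ.* q ℕ.+ p ℕ.* q ≡ (2 ℕ.* q) ℕ.* p
          double = ℕ-Ring.solve-∀

      condition : suc (suc k ℕ.* (K ℕ.* S)) ℕ.< suc K ℕ.^ suc k
      condition = siegel-condition (suc k) k K S [1+k]S≤ (ℕ.≤-trans 2≤[1+k]S [1+k]S≤)
        where
        open ℕ.≤-Reasoning
        exponents : ∀ p q r → p ℕ.+ (q ℕ.+ r) ≡ r ℕ.+ (p ℕ.+ q)
        exponents = ℕ-Ring.solve-∀
        expand : ∀ p q r s → p ℕ.* q ℕ.* r ℕ.+ s ℕ.* p ≡ (q ℕ.* r ℕ.+ s) ℕ.* p
        expand = ℕ-Ring.solve-∀
        [1+k]S≤ : suc k ℕ.* S ℕ.≤ suc K ℕ.^ k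
        [1+k]S≤ = begin
          suc k ℕ.* S
            ≤⟨ ℕ.*-monoˡ-≤ S (ℕ.<⇒≤ (n<2^n (suc k))) ⟩
          2 ℕ.^ suc k ℕ.* S
            ≡⟨ 2^-* (suc k) _ ⟩
          2 ℕ.^ (suc k ℕ.+ (suc (g ℕ.* suc k) ℕ.+ k ℕ.* b ℕ.* m))
            ≡⟨ cong (2 ℕ.^_) (exponents (suc k) (suc (g ℕ.* suc k)) (k ℕ.* b ℕ.* m)) ⟩
          2 ℕ.^ (k ℕ.* b ℕ.* m ℕ.+ h)
            -- Since `k ≥ 1`, `h` may be enlarged to `h k`, which makes the whole bound a k-th
            -- power.
            ≤⟨ ℕ.^-monoʳ-≤ 2 (ℕ.+-monoʳ-≤ (k ℕ.* b ℕ.* m) (ℕ.m≤m*n h k)) ⟩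
          2 ℕ.^ (k ℕ.* b ℕ.* m ℕ.+ h ℕ.* k)
            ≡⟨ cong (2 ℕ.^_) (expand k b m h) ⟩
          2 ℕ.^ ((b ℕ.* m ℕ.+ h) ℕ.* k)
            ≡⟨ ℕ.^-*-assoc 2 (b ℕ.* m ℕ.+ h) k ⟨
          Q ℕ.^ k
            ≡⟨ cong (ℕ._^ k) suc-K ⟨
          suc K ℕ.^ k ∎
        2≤[1+k]S : 2 ℕ.≤ suc k ℕ.* S
        2≤[1+k]S = ℕ.*-mono-≤ (ℕ.s≤s (ℕ.>-nonZero⁻¹ k))
          (ℕ.m^n>0 2 (suc (g ℕ.* suc k) ℕ.+ k ℕ.* b ℕ.* m))

      -- For `p = ∣a_d∣` and `q = ∣x₀∣`. The constant `2^h` in `K` is hidden by passing from the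
      -- parameter `m` to `m + h`.
      size : ∀ p q → p ℕ.≤ K → q ℕ.≤ 2 ℕ.^ (k ℕ.* b ℕ.* m) →
             p ℕ.* q ℕ.≤ 2 ℕ.^ (suc k ℕ.* b ℕ.* (m ℕ.+ h))
      size p q p≤K q≤ = begin
        p ℕ.* q
          ≤⟨ ℕ.*-mono-≤ (ℕ.≤-trans p≤K (ℕ.pred[n]≤n {Q})) q≤ ⟩
        Q ℕ.* 2 ℕ.^ (k ℕ.* b ℕ.* m)
          ≡⟨ 2^-* (b ℕ.* m ℕ.+ h) (k ℕ.* b ℕ.* m) ⟩
        2 ℕ.^ (b ℕ.* m ℕ.+ h ℕ.+ k ℕ.* b ℕ.* m)
          ≤⟨ ℕ.^-monoʳ-≤ 2 (begin
               b ℕ.* m ℕ.+ h ℕ.+ k ℕ.* b ℕ.* m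
                 ≤⟨ ℕ.+-monoˡ-≤ (k ℕ.* b ℕ.* m) (ℕ.+-monoʳ-≤ (b ℕ.* m)
                      (ℕ.m≤n*m h (suc k ℕ.* b) {{ℕ.m*n≢0 (suc k) b}})) ⟩
               b ℕ.* m ℕ.+ suc k ℕ.* b ℕ.* h ℕ.+ k ℕ.* b ℕ.* m
                 ≡⟨ expand b m k h ⟩
               suc k ℕ.* b ℕ.* (m ℕ.+ h) ∎) ⟩
        2 ℕ.^ (suc k ℕ.* b ℕ.* (m ℕ.+ h)) ∎
        where
        open ℕ.≤-Reasoning
        expand : ∀ b m k h → b ℕ.* m ℕ.+ suc k ℕ.* b ℕ.* h ℕ.+ k ℕ.* b ℕ.* m
                           ≡ suc k ℕ.* b ℕ.* (m ℕ.+ h)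
        expand = ℕ-Ring.solve-∀

      -- Of the exponent `b + 1`, the part `b` belongs to the Siegel bound and the part `1` is room
      -- for constants. Among them is `2^(c h)`, because replacing `m` by `m + h` also multiplies
      -- the error by more; hence the lower bound on `m`.
      constants : c ℕ.* h ℕ.+ h ℕ.≤ m →
        2 ℕ.^ (c ℕ.* h) ℕ.* (suc k ℕ.* (K ℕ.* (1 ℕ.+ G))) ℕ.≤ 2 ℕ.^ (suc b ℕ.* (m ℕ.+ h))
      constants m-large = begin
        2 ℕ.^ (c ℕ.* h) ℕ.* (suc k ℕ.* (K ℕ.* (1 ℕ.+ G)))
          ≤⟨ ℕ.*-monoʳ-≤ (2 ℕ.^ (c ℕ.* h)) (ℕ.*-mono-≤ (ℕ.<⇒≤ (n<2^n (suc k)))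
               (ℕ.*-mono-≤ (ℕ.pred[n]≤n {Q}) 1+G≤)) ⟩
        2 ℕ.^ (c ℕ.* h) ℕ.* (2 ℕ.^ suc k ℕ.* (Q ℕ.* 2 ℕ.^ suc (g ℕ.* suc k)))
          ≡⟨ cong (λ p → 2 ℕ.^ (c ℕ.* h) ℕ.* (2 ℕ.^ suc k ℕ.* p)) (2^-* (b ℕ.* m ℕ.+ h) _) ⟩
        2 ℕ.^ (c ℕ.* h) ℕ.* (2 ℕ.^ suc k ℕ.* 2 ℕ.^ (b ℕ.* m ℕ.+ h ℕ.+ suc (g ℕ.* suc k)))
          ≡⟨ cong (2 ℕ.^ (c ℕ.* h) ℕ.*_) (2^-* (suc k) _) ⟩
        2 ℕ.^ (c ℕ.* h) ℕ.* 2 ℕ.^ (suc k ℕ.+ (b ℕ.* m ℕ.+ h ℕ.+ suc (g ℕ.* suc k)))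
          ≡⟨ 2^-* (c ℕ.* h) _ ⟩
        2 ℕ.^ (c ℕ.* h ℕ.+ (suc k ℕ.+ (b ℕ.* m ℕ.+ h ℕ.+ suc (g ℕ.* suc k))))
          ≤⟨ ℕ.^-monoʳ-≤ 2 (begin
               c ℕ.* h ℕ.+ (suc k ℕ.+ (b ℕ.* m ℕ.+ h ℕ.+ suc (g ℕ.* suc k)))
                 ≡⟨ regroup (c ℕ.* h) (suc k) (b ℕ.* m) h (suc (g ℕ.* suc k)) ⟩
               c ℕ.* h ℕ.+ h ℕ.+ (b ℕ.* m ℕ.+ h)
                 ≤⟨ ℕ.+-mono-≤ m-large (ℕ.m≤m+n (b ℕ.* m ℕ.+ h) (b ℕ.* h)) ⟩
               m ℕ.+ (b ℕ.* m ℕ.+ h ℕ.+ b ℕ.* h)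
                 ≡⟨ expand m b h ⟩
               suc b ℕ.* (m ℕ.+ h) ∎) ⟩
        2 ℕ.^ (suc b ℕ.* (m ℕ.+ h)) ∎
        where
        open ℕ.≤-Reasoning
        regroup : ∀ p q r s t → p ℕ.+ (q ℕ.+ (r ℕ.+ s ℕ.+ t)) ≡ p ℕ.+ (q ℕ.+ t) ℕ.+ (r ℕ.+ s)
        regroup = ℕ-Ring.solve-∀
        expand : ∀ m b h → m ℕ.+ (b ℕ.* m ℕ.+ h ℕ.+ b ℕ.* h) ≡ suc b ℕ.* (m ℕ.+ h)
        expand = ℕ-Ring.solve-∀

      rescale : ∀ {η e} → ι (2 ℕ.^ (c ℕ.* m)) * η ≡ 1ℚ → c ℕ.* h ℕ.+ h ℕ.≤ m →
        e ≤ ι (suc k) * (ι K * ((1ℚ + ι G) * η)) →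
        ι (2 ℕ.^ (c ℕ.* (m ℕ.+ h))) * e ≤ ι (2 ℕ.^ (suc b ℕ.* (m ℕ.+ h)))
      rescale {η} {e} Wη≡1 m-large e≤ = begin
        ι (2 ℕ.^ (c ℕ.* (m ℕ.+ h))) * e
          ≤⟨ *-monoˡ (0≤ι (2 ℕ.^ (c ℕ.* (m ℕ.+ h)))) e≤ ⟩
        ι (2 ℕ.^ (c ℕ.* (m ℕ.+ h))) * (ι (suc k) * (ι K * ((1ℚ + ι G) * η)))
          ≡⟨ cong (_* (ι (suc k) * (ι K * ((1ℚ + ι G) * η))))
               (trans (cong ι (trans (cong (2 ℕ.^_) (ℕ.*-distribˡ-+ c m h)) (sym (2^-* (c ℕ.* m) (c ℕ.* h)))))
                 (ι-* W V)) ⟩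
        ι W * ι V * (ι (suc k) * (ι K * ((1ℚ + ι G) * η)))
          ≡⟨ solve 6 (λ w v p q r s → w :* v :* (p :* (q :* (r :* s))) := (w :* s) :* (v :* (p :* (q :* r)))) refl
               (ι W) (ι V) (ι (suc k)) (ι K) (1ℚ + ι G) η ⟩
        ι W * η * (ι V * (ι (suc k) * (ι K * (1ℚ + ι G))))
          ≡⟨ trans (cong (_* (ι V * (ι (suc k) * (ι K * (1ℚ + ι G))))) Wη≡1) (*-identityˡ _) ⟩
        ι V * (ι (suc k) * (ι K * (1ℚ + ι G)))
          ≡⟨ cong (λ p → ι V * (ι (suc k) * (ι K * p)))
               (trans (cong (_+ ι G) (sym (⟦⟧≡/1 1ℤ))) (sym (ι-+ 1 G))) ⟩
        ι V * (ι (suc k) * (ι K * ι (1 ℕ.+ G)))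
          ≡⟨ cong (λ p → ι V * (ι (suc k) * p)) (ι-* K (1 ℕ.+ G)) ⟨
        ι V * (ι (suc k) * ι (K ℕ.* (1 ℕ.+ G)))
          ≡⟨ cong (ι V *_) (ι-* (suc k) _) ⟨
        ι V * ι (suc k ℕ.* (K ℕ.* (1 ℕ.+ G)))
          ≡⟨ ι-* V _ ⟨
        ι (V ℕ.* (suc k ℕ.* (K ℕ.* (1 ℕ.+ G))))
          ≤⟨ ι-mono (constants m-large) ⟩
        ι (2 ℕ.^ (suc b ℕ.* (m ℕ.+ h))) ∎
        where
        open ≤-Reasoning
        W V : ℕ
        W = 2 ℕ.^ (c ℕ.* m)
        V = 2 ℕ.^ (c ℕ.* h)

      reciprocal-≤1 : ∀ {η} → 0ℚ ≤ η → ι (2 ℕ.^ (c ℕ.* m)) * η ≡ 1ℚ → η ≤ 1ℚ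
      reciprocal-≤1 {η} 0≤η Wη≡1 = subst₂ _≤_ (*-identityˡ η) Wη≡1
        (*-monoʳ 0≤η (subst (_≤ ι (2 ℕ.^ (c ℕ.* m))) (⟦⟧≡/1 1ℤ) (ι-mono (ℕ.m^n>0 2 (c ℕ.* m)))))

  -- For `λ = c / (k b)` and `λ′ = (c - b - 1) / ((k + 1) b)` one has
  -- `(k + 1)(1 + λ′) = k (1 + λ) - 1/b`. The denominator is a multiple of `k` so that `X^(1/k)` is
  -- again a power of two.
  approximable-suc : Approximable k ξ 0 c (k ℕ.* b) → Approximable (suc k) ξ (suc b) c (suc k ℕ.* b)
  approximable-suc approx M with approx (M ℕ.+ (c ℕ.* h ℕ.+ h))
  ... | m , m≥ , x , x₀≢0 , x₀≤ , ev =
    conclude (reciprocal (0<ι (2 ℕ.^ (c ℕ.* m)) {{ℕ.m^n≢0 2 (c ℕ.* m)}}))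
    where
    Target : Set
    Target = ∃[ m′ ] (M ℕ.≤ m′ × ∃[ y ] (y 0 ≢ 0ℤ ×
      ℤ.∣ y 0 ∣ ℕ.≤ 2 ℕ.^ (suc k ℕ.* b ℕ.* m′) ×
      Eventually (λ l → ∀ i → i ℕ.≤ suc k →
        ι (2 ℕ.^ (c ℕ.* m′)) * error y (seq ξ l) i ≤ ι (2 ℕ.^ (suc b ℕ.* m′)))))

    conclude : ∃[ η ] (0ℚ < η × ι (2 ℕ.^ (c ℕ.* m)) * η ≡ 1ℚ) → Target
    conclude (η , 0<η , Wη≡1) = from-relation (siegel (suc k) (K m) (S m) x x≤S (condition m))
      where
      Close : ℕ → Set
      Close l = ∣ seq ξ l ∣ ≤ ι (2 ℕ.^ g) × (∀ i → i ℕ.≤ k → error x (seq ξ l) i ≤ η)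

      close : Eventually Close
      close = eventually-map₂ (λ l z≤ e≤ → z≤ , λ i i≤k →
          *-cancelˡ (0<ι (2 ℕ.^ (c ℕ.* m)) {{ℕ.m^n≢0 2 (c ℕ.* m)}})
            (≤-trans (e≤ i i≤k) (≤-reflexive (trans (⟦⟧≡/1 1ℤ) (sym Wη≡1)))))
        (proj₂ (eventually-bounded ξ)) ev

      x≤S : ∀ i → i ℕ.< suc k → ℤ.∣ x i ∣ ℕ.≤ S m
      -- One late term of `ξ` is enough, as the integers `x i` do not depend on it.
      x≤S i i≤k = let N , h = close ; z≤ , e≤ = h N ℕ.≤-refl in
        coordinates≤S m x (seq ξ N) x₀≤ z≤ (reciprocal-≤1 m (<⇒≤ 0<η) Wη≡1)
          i (ℕ.s≤s⁻¹ i≤k) (e≤ i (ℕ.s≤s⁻¹ i≤k))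

      from-relation : ∃[ a ] ((∀ i → ℤ.∣ a i ∣ ℕ.≤ K m) × ¬ (∀ i → i ℕ.< suc k → a i ≡ 0ℤ) ×
                              Σℤ (suc k) (λ i → a i ℤ.* x i) ≡ 0ℤ) → Target
      from-relation (a , a≤K , a≢0 , relation) with leading-term (suc k) a x
      ... | inj₁ a≡0 = contradiction a≡0 a≢0
      ... | inj₂ (d , d<1+k , a_d≢0 , eq) =
        m ℕ.+ h , ℕ.≤-trans (ℕ.m+n≤o⇒m≤o M m≥) (ℕ.m≤m+n m h) , y , y₀≢0 , y₀≤ ,
        (let N , close-from = close in N , λ l N≤l i i≤1+k →
          rescale m Wη≡1 (ℕ.m+n≤o⇒n≤o M m≥)
            (prolongation-close k d s (K m) d≤k d+s≡1+k a x a≤K relation′ (seq ξ l) G (<⇒≤ 0<η)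
              (∣^∣-≤-2^ (seq ξ l) g s (suc k) s≤1+k (proj₁ (close-from l N≤l)))
              (proj₂ (close-from l N≤l)) i i≤1+k))
        where
        d≤k : d ℕ.≤ k
        d≤k = ℕ.s≤s⁻¹ d<1+k
        s : ℕ
        s = suc k ℕ.∸ d
        d+s≡1+k : d ℕ.+ s ≡ suc k
        d+s≡1+k = ℕ.m+[n∸m]≡n (ℕ.<⇒≤ d<1+k)
        s≤1+k : s ℕ.≤ suc k
        s≤1+k = ℕ.m∸n≤m (suc k) d
        relation′ : Σℤ (suc d) (λ i → a i ℤ.* x i) ≡ 0ℤ
        relation′ = trans eq relation
        y : ℕ → ℤ
        y = prolongation k d s (K m) d≤k d+s≡1+k a x a≤K relation′
        y₀≢0 : y 0 ≢ 0ℤ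
        y₀≢0 y₀≡0 with ℤ.i*j≡0⇒i≡0∨j≡0 (a d) y₀≡0
        ... | inj₁ a_d≡0 = a_d≢0 a_d≡0
        ... | inj₂ x₀≡0  = x₀≢0 x₀≡0
        y₀≤ : ℤ.∣ y 0 ∣ ℕ.≤ 2 ℕ.^ (suc k ℕ.* b ℕ.* (m ℕ.+ h))
        y₀≤ = subst (ℕ._≤ 2 ℕ.^ (suc k ℕ.* b ℕ.* (m ℕ.+ h))) (sym (ℤ.abs-* (a d) (x 0)))
          (size m ℤ.∣ a d ∣ ℤ.∣ x 0 ∣ (a≤K d) x₀≤)

-- From powers of two to admissible exponents.

eventually-≤ℝ : ∀ {x y} → Eventually (λ l → seq x l ≤ seq y l) → x ≤ℝ y
eventually-≤ℝ {x} {y} (N , h) ε 0<ε = N , λ l N≤l → ≤-trans (h l N≤l)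
  (subst (_≤ seq y l + ε) (+-identityʳ (seq y l)) (+-monoʳ-≤ (seq y l) (<⇒≤ 0<ε)))

fromℚ-mono-< : ∀ {p q} → p < q → fromℚ p <ℝ fromℚ q
fromℚ-mono-< {p} {q} p<q = q - p ,
  subst (_< q - p) (+-inverseʳ p) (+-monoˡ-< (- p) p<q) ,
  0 , λ _ _ → ≤-reflexive (solve 2 (λ p q → p :+ (q :- p) := q) refl p q)

<ℝ⇒≤ : ∀ {p q} {x y : ℝ} → (∀ l → seq x l ≡ p) → (∀ l → seq y l ≡ q) → x <ℝ y → p ≤ q
<ℝ⇒≤ {p} {q} x≡p y≡q (ε , 0<ε , N , h) = ≤-trans
  (subst (_≤ p + ε) (+-identityʳ p) (+-monoʳ-≤ p (<⇒≤ 0<ε)))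
  (subst₂ (λ u v → u + ε ≤ v) (x≡p N) (y≡q N) (h N ℕ.≤-refl))

seq-^ : ∀ x n l → seq (x ^ℝ n) l ≡ seq x l ^ n
seq-^ x zero    l = refl
seq-^ x (suc n) l = cong (seq x l *_) (seq-^ x n l)

-- With `r = (p - q) / b′` and `t = (u - w) / b`, denominators are cleared and subtracted terms
-- moved across, so that the outcome compares natural exponents of `2`.
fraction-≤ : ∀ {r t} {p q u w b b′ : ℕ} → r * ι b′ ≡ ι p - ι q → t * ι b ≡ ι u - ι w →
  r ≤ t → p ℕ.* b ℕ.+ w ℕ.* b′ ℕ.≤ u ℕ.* b′ ℕ.+ q ℕ.* b
fraction-≤ {r} {t} {p} {q} {u} {w} {b} {b′} r-eq t-eq r≤t = ι-cancel-≤ (begin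
  ι (p ℕ.* b ℕ.+ w ℕ.* b′)
    ≡⟨ expand p b w b′ ⟩
  ι p * ι b + ι w * ι b′
    ≡⟨ solve 5 (λ p q w b c → p :* b :+ w :* c := (p :- q) :* b :+ (q :* b :+ w :* c)) refl
         (ι p) (ι q) (ι w) (ι b) (ι b′) ⟩
  (ι p - ι q) * ι b + (ι q * ι b + ι w * ι b′)
    ≡⟨ cong (λ o → o * ι b + (ι q * ι b + ι w * ι b′)) r-eq ⟨
  r * ι b′ * ι b + (ι q * ι b + ι w * ι b′)
    ≤⟨ +-monoˡ-≤ (ι q * ι b + ι w * ι b′) (*-monoʳ (0≤ι b) (*-monoʳ (0≤ι b′) r≤t)) ⟩
  t * ι b′ * ι b + (ι q * ι b + ι w * ι b′)
    ≡⟨ cong (_+ (ι q * ι b + ι w * ι b′)) (solve 3 (λ t c b → t :* c :* b := t :* b :* c) refl t (ι b′) (ι b)) ⟩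
  t * ι b * ι b′ + (ι q * ι b + ι w * ι b′)
    ≡⟨ cong (λ o → o * ι b′ + (ι q * ι b + ι w * ι b′)) t-eq ⟩
  (ι u - ι w) * ι b′ + (ι q * ι b + ι w * ι b′)
    ≡⟨ solve 5 (λ u q w b c → (u :- w) :* c :+ (q :* b :+ w :* c) := u :* c :+ q :* b) refl
         (ι u) (ι q) (ι w) (ι b) (ι b′) ⟩
  ι u * ι b′ + ι q * ι b
    ≡⟨ expand u b′ q b ⟨
  ι (u ℕ.* b′ ℕ.+ q ℕ.* b) ∎)
  where
  open ≤-Reasoning
  expand : ∀ k l m n → ι (k ℕ.* l ℕ.+ m ℕ.* n) ≡ ι k * ι l + ι m * ι n
  expand k l m n = trans (ι-+ (k ℕ.* l) (m ℕ.* n)) (cong₂ _+_ (ι-* k l) (ι-* m n))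

/-⊖ : ∀ m n b .{{_ : ℕ.NonZero b}} → ((m ⊖ n) / b) * ι b ≡ ι m - ι n
/-⊖ m n b = trans (/-*-cancel (m ⊖ n) b) (⟦⟧-⊖ m n)

-‿/-⊖ : ∀ m n b .{{_ : ℕ.NonZero b}} → (- ((m ⊖ n) / b)) * ι b ≡ ι n - ι m
-‿/-⊖ m n b = begin
  (- ((m ⊖ n) / b)) * ι b   ≡⟨ neg-distribˡ-* ((m ⊖ n) / b) (ι b) ⟨
  - (((m ⊖ n) / b) * ι b)   ≡⟨ cong -_ (/-⊖ m n b) ⟩
  - (ι m - ι n)             ≡⟨ solve 2 (λ p q → :- (p :- q) := q :- p) refl (ι m) (ι n) ⟩
  ι n - ι m                 ∎
  where open ≡-Reasoning

module _ (m a c b : ℕ) .{{_ : ℕ.NonZero b}} {η : ℚ} (0<η : 0ℚ < η)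
         (Vη≡1 : ι (2 ℕ.^ (c ℕ.* m)) * η ≡ 1ℚ) where

  private

    X Y V A : ℚ
    X = ι (2 ℕ.^ (b ℕ.* m))
    V = ι (2 ℕ.^ (c ℕ.* m))
    A = ι (2 ℕ.^ (a ℕ.* m))
    Y = A * η

    0<V : 0ℚ < V
    0<V = 0<ι (2 ℕ.^ (c ℕ.* m)) {{ℕ.m^n≢0 2 (c ℕ.* m)}}

    0<Y : 0ℚ < Y
    0<Y = positive⁻¹ Y {{pos*pos⇒pos A
      {{positive (0<ι (2 ℕ.^ (a ℕ.* m)) {{ℕ.m^n≢0 2 (a ℕ.* m)}})}} η {{positive 0<η}}}}

    powers : ∀ p q r s → ι (2 ℕ.^ (p ℕ.* m)) ^ q * ι (2 ℕ.^ (r ℕ.* m)) ^ s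
                       ≡ ι (2 ℕ.^ ((q ℕ.* p ℕ.+ r ℕ.* s) ℕ.* m))
    powers p q r s = begin
      ι (2 ℕ.^ (p ℕ.* m)) ^ q * ι (2 ℕ.^ (r ℕ.* m)) ^ s
        ≡⟨ cong₂ _*_ (power p q) (power r s) ⟩
      ι (2 ℕ.^ (p ℕ.* m ℕ.* q)) * ι (2 ℕ.^ (r ℕ.* m ℕ.* s))
        ≡⟨ ι-* (2 ℕ.^ (p ℕ.* m ℕ.* q)) (2 ℕ.^ (r ℕ.* m ℕ.* s)) ⟨
      ι (2 ℕ.^ (p ℕ.* m ℕ.* q) ℕ.* 2 ℕ.^ (r ℕ.* m ℕ.* s))
        ≡⟨ cong ι (ℕ.^-distribˡ-+-* 2 (p ℕ.* m ℕ.* q) (r ℕ.* m ℕ.* s)) ⟨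
      ι (2 ℕ.^ (p ℕ.* m ℕ.* q ℕ.+ r ℕ.* m ℕ.* s))
        ≡⟨ cong (λ e → ι (2 ℕ.^ e)) (regroup p q r s m) ⟩
      ι (2 ℕ.^ ((q ℕ.* p ℕ.+ r ℕ.* s) ℕ.* m)) ∎
      where
      open ≡-Reasoning
      power : ∀ p q → ι (2 ℕ.^ (p ℕ.* m)) ^ q ≡ ι (2 ℕ.^ (p ℕ.* m ℕ.* q))
      power p q = trans (sym (ι-^ (2 ℕ.^ (p ℕ.* m)) q)) (cong ι (ℕ.^-*-assoc 2 (p ℕ.* m) q))
      regroup : ∀ p q r s m → p ℕ.* m ℕ.* q ℕ.+ r ℕ.* m ℕ.* s ≡ (q ℕ.* p ℕ.+ r ℕ.* s) ℕ.* m
      regroup = ℕ-Ring.solve-∀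

    -- `Y` contains the negative power `η = 2^(-c m)`; the factor `V ^ b′` removes it.
    clear-denominator : ∀ c′ b′ → X ^ c′ * Y ^ b′ * V ^ b′ ≡ ι (2 ℕ.^ ((c′ ℕ.* b ℕ.+ a ℕ.* b′) ℕ.* m))
    clear-denominator c′ b′ = begin
      X ^ c′ * Y ^ b′ * V ^ b′     ≡⟨ *-assoc (X ^ c′) (Y ^ b′) (V ^ b′) ⟩
      X ^ c′ * (Y ^ b′ * V ^ b′)   ≡⟨ cong (X ^ c′ *_) (^-distrib-* Y V b′) ⟨
      X ^ c′ * (Y * V) ^ b′        ≡⟨ cong (λ p → X ^ c′ * p ^ b′) (trans (*-comm Y V) (reciprocal-cancel V A Vη≡1)) ⟩
      X ^ c′ * A ^ b′              ≡⟨ powers b c′ a b′ ⟩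
      ι (2 ℕ.^ ((c′ ℕ.* b ℕ.+ a ℕ.* b′) ℕ.* m)) ∎
      where open ≡-Reasoning

    mono : ∀ {p q} → p ℕ.≤ q → ι (2 ℕ.^ (p ℕ.* m)) ≤ ι (2 ℕ.^ (q ℕ.* m))
    mono p≤q = ι-mono (ℕ.^-monoʳ-≤ 2 (ℕ.*-monoˡ-≤ m p≤q))

    seq-X^ : ∀ n l → seq (fromℚ X ^ℝ n) l ≡ X ^ n
    seq-X^ n l = seq-^ (fromℚ X) n l

    seq-X^*Y^ : ∀ c′ b′ l → seq ((fromℚ X ^ℝ c′) *ℝ (fromℚ Y ^ℝ b′)) l ≡ X ^ c′ * Y ^ b′
    seq-X^*Y^ c′ b′ l = cong₂ _*_ (seq-X^ c′ l) (seq-^ (fromℚ Y) b′ l)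

  -- After multiplication by `V ^ b′` each condition compares two powers of `2`, and the order of
  -- their exponents follows from that of `(a′ - c′) / b′` and `(a - c) / b`.
  dyadic-isPower : IsPower (fromℚ X) (-ℝ fromℚ ((c ⊖ a) / b)) (fromℚ Y)
  dyadic-isPower = record
    { y>0   = fromℚ-mono-< 0<Y
    ; lower = λ a′ c′ b′ r<t →
        eventually-≤ℝ {fromℚ X ^ℝ a′} {(fromℚ X ^ℝ c′) *ℝ (fromℚ Y ^ℝ b′)}
          (0 , λ l _ → subst₂ _≤_ (sym (seq-X^ a′ l)) (sym (seq-X^*Y^ c′ b′ l))
            (*-cancelʳ (0<^ b′ 0<V)
              (subst₂ _≤_ (sym (powers b a′ c b′)) (sym (clear-denominator c′ b′))
                (mono (subst (a′ ℕ.* b ℕ.+ c ℕ.* b′ ℕ.≤_) (ℕ.+-comm (a ℕ.* b′) (c′ ℕ.* b))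
                  (fraction-≤ {p = a′} {c′} {a} {c} {b} {b′} (/-⊖ a′ c′ b′) (-‿/-⊖ c a b)
                    (<ℝ⇒≤ {x = fromℚ ((a′ ⊖ c′) / b′)} {y = -ℝ fromℚ ((c ⊖ a) / b)}
                      (λ _ → refl) (λ _ → refl) r<t)))))))
    ; upper = λ a′ c′ b′ t<r →
        eventually-≤ℝ {(fromℚ X ^ℝ c′) *ℝ (fromℚ Y ^ℝ b′)} {fromℚ X ^ℝ a′}
          (0 , λ l _ → subst₂ _≤_ (sym (seq-X^*Y^ c′ b′ l)) (sym (seq-X^ a′ l))
            (*-cancelʳ (0<^ b′ 0<V)
              (subst₂ _≤_ (sym (clear-denominator c′ b′)) (sym (powers b a′ c b′))
                (mono (subst (ℕ._≤ a′ ℕ.* b ℕ.+ c ℕ.* b′) (ℕ.+-comm (a ℕ.* b′) (c′ ℕ.* b))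
                  (fraction-≤ {p = a} {c} {a′} {c′} {b′} {b} (-‿/-⊖ c a b) (/-⊖ a′ c′ b′)
                    (<ℝ⇒≤ {x = -ℝ fromℚ ((c ⊖ a) / b)} {y = fromℚ ((a′ ⊖ c′) / b′)}
                      (λ _ → refl) (λ _ → refl) t<r)))))))
    }

seq-error : ∀ ξ l i p q → ∣ (p / 1) * seq (ξ ^ℝ i) l - q / 1 ∣ ≡ ∣ ⟦ p ⟧ * seq ξ l ^ i - ⟦ q ⟧ ∣
seq-error ξ l i p q = cong₂ (λ u v → ∣ u - v ∣)
  (cong₂ _*_ (sym (⟦⟧≡/1 p)) (seq-^ ξ i l)) (sym (⟦⟧≡/1 q))

approximable⇒admissible : ∀ {n ξ} a c b .{{_ : ℕ.NonZero b}} → Approximable n ξ a c b →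
                          Admissible n ξ (fromℚ ((c ⊖ a) / b))
approximable⇒admissible {n} {ξ} a c b approx B =
  -- As `b ≥ 1`, any `m ≥ M` makes `X = 2^(b m)` at least `B`.
  let M , N , B≤2^M = eventually-bounded B
      m , M≤m , x , x₀≢0 , x₀≤ , N′ , close = approx M
      η , 0<η , Vη≡1 = reciprocal (0<V m)
  in fromℚ (X m) ,
     eventually-≤ℝ {B} {fromℚ (X m)} (N , λ l N≤l → ≤-trans (p≤∣p∣ (seq B l))
       (≤-trans (B≤2^M l N≤l) (ι-mono (ℕ.^-monoʳ-≤ 2 (ℕ.≤-trans M≤m (ℕ.m≤n*m m b)))))) ,
     eventually-≤ℝ {1ℝ} {fromℚ (X m)} (0 , λ _ _ →
       subst (_≤ X m) (⟦⟧≡/1 1ℤ) (ι-mono (ℕ.m^n>0 2 (b ℕ.* m)))) ,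
     fromℚ (ι (2 ℕ.^ (a ℕ.* m)) * η) ,
     dyadic-isPower m a c b 0<η Vη≡1 ,
     x ∘ toℕ ,
     solution m x x₀≢0 x₀≤ N′ close η Vη≡1
  where
  X : ℕ → ℚ
  X m = ι (2 ℕ.^ (b ℕ.* m))

  0<V : ∀ m → 0ℚ < ι (2 ℕ.^ (c ℕ.* m))
  0<V m = 0<ι (2 ℕ.^ (c ℕ.* m)) {{ℕ.m^n≢0 2 (c ℕ.* m)}}

  solution : ∀ m x → x 0 ≢ 0ℤ → ℤ.∣ x 0 ∣ ℕ.≤ 2 ℕ.^ (b ℕ.* m) →
    ∀ N → (∀ l → N ℕ.≤ l → ∀ i → i ℕ.≤ n →
      ι (2 ℕ.^ (c ℕ.* m)) * error x (seq ξ l) i ≤ ι (2 ℕ.^ (a ℕ.* m))) →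
    ∀ η → ι (2 ℕ.^ (c ℕ.* m)) * η ≡ 1ℚ →
    Solution n ξ (fromℚ (X m)) (fromℚ (ι (2 ℕ.^ (a ℕ.* m)) * η)) (x ∘ toℕ)
  solution m x x₀≢0 x₀≤ N close η Vη≡1 =
    (1ℚ , positive⁻¹ 1ℚ , 0 , λ _ _ → subst₂ _≤_ (⟦⟧≡/1 1ℤ) (sym ∣x₀∣)
      (ι-mono (ℕ.n≢0⇒n>0 (λ eq → x₀≢0 (ℤ.∣i∣≡0⇒i≡0 eq))))) ,
    eventually-≤ℝ {∣ fromℤ (x 0) ∣ℝ} {fromℚ (X m)}
      (0 , λ _ _ → subst (_≤ X m) (sym ∣x₀∣) (ι-mono x₀≤)) ,
    λ i → eventually-≤ℝ {∣ fromℤ (x 0) *ℝ (ξ ^ℝ suc (toℕ i)) -ℝ fromℤ (x (suc (toℕ i))) ∣ℝ} {fromℚ Y}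
      (N , λ l N≤l → subst (_≤ Y) (sym (seq-error ξ l (suc (toℕ i)) (x 0) (x (suc (toℕ i)))))
        (*-cancelˡ (0<V m)
          (≤-trans (close l N≤l (suc (toℕ i)) (Fin.toℕ<n i)) (≤-reflexive (sym (reciprocal-cancel V A Vη≡1))))))
    where
    A V Y : ℚ
    A = ι (2 ℕ.^ (a ℕ.* m))
    V = ι (2 ℕ.^ (c ℕ.* m))
    Y = A * η
    ∣x₀∣ : ∣ x 0 / 1 ∣ ≡ ι ℤ.∣ x 0 ∣
    ∣x₀∣ = trans (cong ∣_∣ (sym (⟦⟧≡/1 (x 0)))) (⟦⟧-∣∣ (x 0))

approximable⇒below : ∀ {n ξ q} a c b .{{_ : ℕ.NonZero b}} → Approximable n ξ a c b →
                     q * ι b < ι c - ι a → below (λ[ n ] ξ) q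
approximable⇒below {n} {ξ} {q} a c b approx q< =
  fromℚ ((c ⊖ a) / b) , approximable⇒admissible a c b approx ,
  fromℚ-mono-< {q} (*-cancelʳ-<-nonNeg (ι b) {{nonNegative (0≤ι b)}} {q}
    (subst (q * ι b <_) (sym (/-⊖ c a b)) q<))

-- Negative rationals always lie below the exponent.

archimedes-* : ∀ {ε} → 0ℚ < ε → ∀ r → ∃[ n ] r ≤ ε * ι (suc n)
archimedes-* {ε} 0<ε r with reciprocal 0<ε
... | δ , 0<δ , εδ≡1 with archimedes (δ * r)
... | n , δr≤n = n , (begin
  r               ≡⟨ *-identityˡ r ⟨
  1ℚ * r          ≡⟨ cong (_* r) εδ≡1 ⟨
  ε * δ * r       ≡⟨ *-assoc ε δ r ⟩
  ε * (δ * r)     ≤⟨ *-monoˡ (<⇒≤ 0<ε) (≤-trans δr≤n (ι-mono (ℕ.n≤1+n n))) ⟩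
  ε * ι (suc n)   ∎)
  where open ≤-Reasoning

unit : ℕ → ℤ
unit zero    = 1ℤ
unit (suc _) = 0ℤ

error-unit : ∀ z i → error unit z (suc i) ≡ ∣ z ^ suc i ∣
error-unit z i = cong ∣_∣ (begin
  ⟦ 1ℤ ⟧ * z ^ suc i - ⟦ 0ℤ ⟧   ≡⟨ cong₂ (λ p q → p * z ^ suc i - q) (⟦⟧≡/1 1ℤ) (⟦⟧≡/1 0ℤ) ⟩
  1ℚ * z ^ suc i - 0ℚ           ≡⟨ cong (_- 0ℚ) (*-identityˡ (z ^ suc i)) ⟩
  z ^ suc i - 0ℚ                ≡⟨ +-identityʳ (z ^ suc i) ⟩
  z ^ suc i                     ∎)
  where open ≡-Reasoning

error-unit-≤ : ∀ n {z g} → ∣ z ∣ ≤ ι (2 ℕ.^ g) → ∀ i → i ℕ.≤ n → error unit z i ≤ ι (2 ℕ.^ (g ℕ.* n))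
error-unit-≤ n {z} {g} z≤ zero    i≤n = subst (_≤ ι (2 ℕ.^ (g ℕ.* n))) (sym (error-zero unit z)) (0≤ι _)
error-unit-≤ n {z} {g} z≤ (suc i) i≤n = subst (_≤ ι (2 ℕ.^ (g ℕ.* n))) (sym (error-unit z i))
  (∣^∣-≤-2^ z g (suc i) n i≤n z≤)

-- The vector `(1, 0, …, 0)` has bounded errors, and any bound is at most `2^m = X^(1/b)` once `m`
-- is large. The resulting exponents `-1/b` come arbitrarily close to `0`.
trivial-approximation : ∀ n ξ b → Approximable n ξ 1 0 b
trivial-approximation n ξ b M = from-bound (eventually-bounded ξ)
  where
  open ≤-Reasoning

  small : ∀ g z → ∣ z ∣ ≤ ι (2 ℕ.^ g) → ∀ i → i ℕ.≤ n →
          ι (2 ℕ.^ 0) * error unit z i ≤ ι (2 ℕ.^ (1 ℕ.* (M ℕ.+ g ℕ.* n)))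
  small g z z≤ i i≤n = begin
    ι 1 * error unit z i                ≡⟨ cong (_* error unit z i) (⟦⟧≡/1 1ℤ) ⟩
    1ℚ * error unit z i                 ≡⟨ *-identityˡ (error unit z i) ⟩
    error unit z i                      ≤⟨ error-unit-≤ n {z} {g} z≤ i i≤n ⟩
    ι (2 ℕ.^ (g ℕ.* n))                 ≤⟨ ι-mono (ℕ.^-monoʳ-≤ 2 (ℕ.m≤n+m (g ℕ.* n) M)) ⟩
    ι (2 ℕ.^ (M ℕ.+ g ℕ.* n))           ≡⟨ cong (λ e → ι (2 ℕ.^ e)) (ℕ.*-identityˡ (M ℕ.+ g ℕ.* n)) ⟨
    ι (2 ℕ.^ (1 ℕ.* (M ℕ.+ g ℕ.* n)))   ∎

  from-bound : ∃[ g ] Eventually (λ l → ∣ seq ξ l ∣ ≤ ι (2 ℕ.^ g)) →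
    ∃[ m ] (M ℕ.≤ m × ∃[ x ] (x 0 ≢ 0ℤ ×
      ℤ.∣ x 0 ∣ ℕ.≤ 2 ℕ.^ (b ℕ.* m) ×
      Eventually (λ l → ∀ i → i ℕ.≤ n → ι (2 ℕ.^ 0) * error x (seq ξ l) i ≤ ι (2 ℕ.^ (1 ℕ.* m)))))
  from-bound (g , N , ξ≤2^g) =
    M ℕ.+ g ℕ.* n , ℕ.m≤m+n M (g ℕ.* n) , unit , (λ ()) , ℕ.m^n>0 2 (b ℕ.* (M ℕ.+ g ℕ.* n)) ,
    N , λ l N≤l → small g (seq ξ l) (ξ≤2^g l N≤l)

negative-below : ∀ n ξ {q} → q < 0ℚ → below (λ[ n ] ξ) q
-- Asking for `2` in place of `1` gives the strict inequality `q < -1/(b + 1)`.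
negative-below n ξ {q} q<0 = let b , 2≤ = archimedes-* { - q} (neg-antimono-< q<0) (ι 2) in
  approximable⇒below {n} {ξ} {q} 1 0 (suc b) (trivial-approximation n ξ (suc b)) (bound b 2≤)
  where
  open ≤-Reasoning
  bound : ∀ b → ι 2 ≤ - q * ι (suc b) → q * ι (suc b) < ι 0 - ι 1
  bound b 2≤ = begin-strict
    q * ι (suc b)         ≡⟨ solve 2 (λ p r → p :* r := :- ((:- p) :* r)) refl q (ι (suc b)) ⟩
    - (- q * ι (suc b))   ≤⟨ neg-antimono-≤ 2≤ ⟩
    - ι 2                 <⟨ neg-antimono-< (ι-mono-< {1} {2} ℕ.≤-refl) ⟩
    - ι 1                 ≡⟨ +-identityˡ (- ι 1) ⟨
    0ℚ - ι 1              ≡⟨ cong (_- ι 1) (⟦⟧≡/1 0ℤ) ⟨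
    ι 0 - ι 1             ∎

-- From admissible exponents to powers of two.

first-step : ∀ {P : ℕ → Set} → (∀ m → Dec (P m)) → ∀ n → P n → ¬ P 0 → ∃[ m ] (¬ P m × P (suc m))
first-step P? zero    Pn ¬P0 = contradiction Pn ¬P0
first-step P? (suc n) Pn ¬P0 with P? n
... | yes Pn′ = first-step P? n Pn′ ¬P0
... | no ¬Pn  = n , ¬Pn , Pn

-- The search relies on decidable comparison of rationals; this is why a real `X` is first replaced
-- by a rational near one of its terms.
bracket : ∀ b .{{_ : ℕ.NonZero b}} M r → ι (2 ℕ.^ (b ℕ.* M)) < r →
  ∃[ j ] (ι (2 ℕ.^ (b ℕ.* (j ℕ.+ M))) < r × r ≤ ι (2 ℕ.^ (b ℕ.* suc (j ℕ.+ M))))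
bracket b M r 2^<r =
  let n , r≤2^n = below-2^ r
      j , above , under = first-step (λ j → r ≤? ι (2 ℕ.^ (b ℕ.* (j ℕ.+ M)))) n
        (≤-trans r≤2^n (ι-mono (ℕ.^-monoʳ-≤ 2 (ℕ.≤-trans (ℕ.m≤m+n n M) (ℕ.m≤n*m (n ℕ.+ M) b)))))
        (λ r≤ → <-irrefl refl (<-≤-trans 2^<r r≤))
  in j , ≰⇒> above , under

eventually-all : ∀ n {P : ℕ → ℕ → Set} → (∀ i → i ℕ.≤ n → Eventually (P i)) →
                 Eventually (λ l → ∀ i → i ℕ.≤ n → P i l)
eventually-all zero {P} h = let N , p = h 0 ℕ.z≤n in N , λ { l N≤l .0 ℕ.z≤n → p l N≤l }
eventually-all (suc n) {P} h = eventually-map₂ both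
  (eventually-all n (λ i i≤n → h i (ℕ.m≤n⇒m≤1+n i≤n))) (h (suc n) ℕ.≤-refl)
  where
  both : ∀ l → (∀ i → i ℕ.≤ n → P i l) → P (suc n) l → ∀ i → i ℕ.≤ suc n → P i l
  both l p q i i≤1+n with ℕ.m≤n⇒m<n∨m≡n i≤1+n
  ... | inj₁ i<1+n = p i (ℕ.s≤s⁻¹ i<1+n)
  ... | inj₂ refl  = q

-- The b-th power of `2^(m C) Y` is at most `X ^ C * Y ^ b`, hence at most `2`, hence at most
-- `2 ^ b`.
root-bound : ∀ {X Y} m C b .{{_ : ℕ.NonZero b}} → ι (2 ℕ.^ (b ℕ.* m)) ≤ X → 0ℚ ≤ Y →
             X ^ C * Y ^ b ≤ ι 2 → ι (2 ℕ.^ (m ℕ.* C)) * Y ≤ ι 2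
root-bound {X} {Y} m C b 2^≤X 0≤Y XY≤2 = ^-cancel-≤ b (0≤ι 2) (begin
  (ι (2 ℕ.^ (m ℕ.* C)) * Y) ^ b          ≡⟨ ^-distrib-* (ι (2 ℕ.^ (m ℕ.* C))) Y b ⟩
  ι (2 ℕ.^ (m ℕ.* C)) ^ b * Y ^ b        ≡⟨ cong (_* Y ^ b) exchange ⟩
  ι (2 ℕ.^ (b ℕ.* m)) ^ C * Y ^ b        ≤⟨ *-monoʳ (0≤^ b 0≤Y) (^-mono C (0≤ι (2 ℕ.^ (b ℕ.* m))) 2^≤X) ⟩
  X ^ C * Y ^ b                          ≤⟨ XY≤2 ⟩
  ι (2 ℕ.^ 1)                            ≤⟨ ι-mono (ℕ.^-monoʳ-≤ 2 (ℕ.>-nonZero⁻¹ b)) ⟩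
  ι (2 ℕ.^ b)                            ≡⟨ ι-^ 2 b ⟩
  ι 2 ^ b                                ∎)
  where
  open ≤-Reasoning
  regroup : ∀ m C b → m ℕ.* C ℕ.* b ≡ b ℕ.* m ℕ.* C
  regroup = ℕ-Ring.solve-∀
  exchange : ι (2 ℕ.^ (m ℕ.* C)) ^ b ≡ ι (2 ℕ.^ (b ℕ.* m)) ^ C
  exchange = trans (sym (ι-^ (2 ℕ.^ (m ℕ.* C)) b)) (trans
    (cong ι (trans (ℕ.^-*-assoc 2 (m ℕ.* C) b)
      (trans (cong (2 ℕ.^_) (regroup m C b)) (sym (ℕ.^-*-assoc 2 (b ℕ.* m) C)))))
    (ι-^ (2 ℕ.^ (b ℕ.* m)) C))

-- Replacing the exponent c + 1 by c pays for all constants once m is large.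
weaken-exponent : ∀ {Y δ e} m c → c ℕ.* 2 ℕ.+ 2 ℕ.≤ m → 0ℚ ≤ e → ι (2 ℕ.^ (m ℕ.* suc c)) * δ ≡ 1ℚ →
  ι (2 ℕ.^ (m ℕ.* suc c)) * Y ≤ ι 2 → e ≤ Y + δ → ι (2 ℕ.^ (c ℕ.* (2 ℕ.+ m))) * e ≤ ι 1
weaken-exponent {Y} {δ} {e} m c m-large 0≤e Pδ≡1 PY≤2 e≤ = *-cancelˡ (0<ι 4) (begin
  ι 4 * (ι (2 ℕ.^ (c ℕ.* (2 ℕ.+ m))) * e)   ≡⟨ *-assoc (ι 4) (ι (2 ℕ.^ (c ℕ.* (2 ℕ.+ m)))) e ⟨
  ι 4 * ι (2 ℕ.^ (c ℕ.* (2 ℕ.+ m))) * e     ≡⟨ cong (_* e) (ι-* 4 (2 ℕ.^ (c ℕ.* (2 ℕ.+ m)))) ⟨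
  ι (4 ℕ.* 2 ℕ.^ (c ℕ.* (2 ℕ.+ m))) * e     ≡⟨ cong (λ p → ι p * e) (ℕ.^-distribˡ-+-* 2 2 (c ℕ.* (2 ℕ.+ m))) ⟨
  ι (2 ℕ.^ (2 ℕ.+ c ℕ.* (2 ℕ.+ m))) * e     ≤⟨ *-monoʳ 0≤e (ι-mono (ℕ.^-monoʳ-≤ 2 exponents)) ⟩
  ι (2 ℕ.^ (m ℕ.* suc c)) * e               ≤⟨ *-monoˡ (0≤ι (2 ℕ.^ (m ℕ.* suc c))) e≤ ⟩
  ι (2 ℕ.^ (m ℕ.* suc c)) * (Y + δ)         ≡⟨ *-distribˡ-+ (ι (2 ℕ.^ (m ℕ.* suc c))) Y δ ⟩
  ι (2 ℕ.^ (m ℕ.* suc c)) * Y + ι (2 ℕ.^ (m ℕ.* suc c)) * δ   ≤⟨ +-mono-≤ PY≤2 (≤-reflexive Pδ≡1) ⟩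
  ι 2 + 1ℚ                                  ≡⟨ ι-suc 2 ⟨
  ι 3                                       ≤⟨ ι-mono (ℕ.n≤1+n 3) ⟩
  ι 4                                       ≡⟨ *-identityʳ (ι 4) ⟨
  ι 4 * 1ℚ                                  ≡⟨ cong (ι 4 *_) (⟦⟧≡/1 1ℤ) ⟨
  ι 4 * ι 1                                 ∎)
  where
  open ≤-Reasoning
  exponents : 2 ℕ.+ c ℕ.* (2 ℕ.+ m) ℕ.≤ m ℕ.* suc c
  exponents = subst₂ ℕ._≤_ (left c m) (right c m) (ℕ.+-monoˡ-≤ (c ℕ.* m) m-large)
    where
    left : ∀ c m → c ℕ.* 2 ℕ.+ 2 ℕ.+ c ℕ.* m ≡ 2 ℕ.+ c ℕ.* (2 ℕ.+ m)
    left = ℕ-Ring.solve-∀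
    right : ∀ c m → m ℕ.+ c ℕ.* m ≡ m ℕ.* suc c
    right = ℕ-Ring.solve-∀

-- The `3` is the uncertainty in reading off `X`: `2` is added to the sampled term, and later terms
-- may oscillate by `1`.
2^-gap : ∀ b .{{_ : ℕ.NonZero b}} m → 2 ℕ.≤ m → 2 ℕ.^ (b ℕ.* m) ℕ.+ 3 ℕ.≤ 2 ℕ.^ (b ℕ.* suc m)
2^-gap b m 2≤m = begin
  2 ℕ.^ (b ℕ.* m) ℕ.+ 3                   ≤⟨ ℕ.+-monoʳ-≤ (2 ℕ.^ (b ℕ.* m)) (ℕ.n≤1+n 3) ⟩
  2 ℕ.^ (b ℕ.* m) ℕ.+ 2 ℕ.^ 2             ≤⟨ ℕ.+-monoʳ-≤ (2 ℕ.^ (b ℕ.* m)) (ℕ.^-monoʳ-≤ 2 (ℕ.≤-trans 2≤m (ℕ.m≤n*m m b))) ⟩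
  2 ℕ.^ (b ℕ.* m) ℕ.+ 2 ℕ.^ (b ℕ.* m)     ≡⟨ cong (2 ℕ.^ (b ℕ.* m) ℕ.+_) (ℕ.+-identityʳ (2 ℕ.^ (b ℕ.* m))) ⟨
  2 ℕ.^ (1 ℕ.+ b ℕ.* m)                   ≤⟨ ℕ.^-monoʳ-≤ 2 (ℕ.+-monoˡ-≤ (b ℕ.* m) (ℕ.>-nonZero⁻¹ b)) ⟩
  2 ℕ.^ (b ℕ.+ b ℕ.* m)                   ≡⟨ cong (2 ℕ.^_) (ℕ.*-suc b m) ⟨
  2 ℕ.^ (b ℕ.* suc m)                     ∎
  where open ℕ.≤-Reasoning

∣p-q∣≤r⇒p≤q+r : ∀ p q {r} → ∣ p - q ∣ ≤ r → p ≤ q + r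
∣p-q∣≤r⇒p≤q+r p q {r} h = subst (_≤ q + r) (solve 2 (λ p q → q :+ (p :- q) := p) refl p q)
  (+-monoʳ-≤ q (≤-trans (p≤∣p∣ (p - q)) h))

-- The hypothesis says `s > (c + 1) / b`, while only `c / b` is claimed: the difference pays for
-- rounding `X` to a power of two and for the tolerances in real inequalities.
admissible⇒approximable : ∀ {n ξ s} c b .{{_ : ℕ.NonZero b}} → Admissible n ξ s →
  (-ℝ s) <ℝ fromℚ ((0 ⊖ suc c) / b) → Approximable n ξ 0 c b
admissible⇒approximable {n} {ξ} {s} c b adm -s< M =
  let X , B≤X , _ , Y , isPower , x , sol = adm (fromℚ (ι (2 ℕ.^ (b ℕ.* suc M₀))))
  in from-solution X Y x isPower sol B≤X
  where
  M₀ : ℕ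
  M₀ = M ℕ.+ (c ℕ.* 2 ℕ.+ 2)

  Target : Set
  Target = ∃[ m ] (M ℕ.≤ m × ∃[ x ] (x 0 ≢ 0ℤ ×
    ℤ.∣ x 0 ∣ ℕ.≤ 2 ℕ.^ (b ℕ.* m) ×
    Eventually (λ l → ∀ i → i ℕ.≤ n → ι (2 ℕ.^ (c ℕ.* m)) * error x (seq ξ l) i ≤ ι 1)))

  module _ (X Y : ℝ) (x : Fin (suc n) → ℤ) (isPower : IsPower X (-ℝ s) Y)
           (sol : Solution n ξ X Y x) where

    open IsPower isPower

    x′ : ℕ → ℤ
    x′ = extend 0ℤ x

    x₀≢0 : x′ 0 ≢ 0ℤ
    x₀≢0 x₀≡0 = let ε , 0<ε , N , h = proj₁ sol in
      <-irrefl refl (<-≤-trans 0<ε (subst₂ _≤_ (+-identityˡ ε) (cong (λ p → ∣ p / 1 ∣) x₀≡0) (h N ℕ.≤-refl)))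

    Y≥0 : Eventually (λ l → 0ℚ ≤ seq Y l)
    Y≥0 = let ε , 0<ε , N , h = y>0 in
      N , λ l N≤l → ≤-trans (<⇒≤ 0<ε) (subst (_≤ seq Y l) (+-identityˡ ε) (h l N≤l))

    X^C*Y^b≤2 : Eventually (λ l → seq X l ^ suc c * seq Y l ^ b ≤ ι 2)
    -- With `0` as the positive part of the exponent the right-hand side is `X^0 = 1`; the tolerance
    -- `1` of `_≤ℝ_` raises it to `2`.
    X^C*Y^b≤2 = let N , h = upper 0 (suc c) b -s< 1ℚ (positive⁻¹ 1ℚ) in
      N , λ l N≤l → subst₂ _≤_ (cong₂ _*_ (seq-^ X (suc c) l) (seq-^ Y b l)) (sym (⟦⟧≡/1 (+ 2))) (h l N≤l)

    x₀≤ : Eventually (λ l → ι ℤ.∣ x′ 0 ∣ ≤ seq X l + 1ℚ)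
    x₀≤ = let N , h = proj₁ (proj₂ sol) 1ℚ (positive⁻¹ 1ℚ) in
      N , λ l N≤l → subst (_≤ seq X l + 1ℚ)
        (trans (cong ∣_∣ (sym (⟦⟧≡/1 (x′ 0)))) (⟦⟧-∣∣ (x′ 0))) (h l N≤l)

    errors : ∀ δ → 0ℚ < δ → ∀ (i : Fin n) →
             Eventually (λ l → error x′ (seq ξ l) (suc (toℕ i)) ≤ seq Y l + δ)
    errors δ 0<δ i = let N , h = proj₂ (proj₂ sol) i δ 0<δ in
      N , λ l N≤l → subst (_≤ seq Y l + δ) (trans
        (seq-error ξ l (suc (toℕ i)) (x Fin.zero) (x (Fin.suc i)))
        (cong (λ e → ∣ ⟦ x Fin.zero ⟧ * seq ξ l ^ suc (toℕ i) - ⟦ e ⟧ ∣) (sym (extend-toℕ 0ℤ x (Fin.suc i)))))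
        (h l N≤l)

    all-errors : ∀ m → c ℕ.* 2 ℕ.+ 2 ℕ.≤ m → Eventually (λ l → ι (2 ℕ.^ (b ℕ.* m)) ≤ seq X l) →
      Eventually (λ l → ∀ i → i ℕ.≤ n → ι (2 ℕ.^ (c ℕ.* (2 ℕ.+ m))) * error x′ (seq ξ l) i ≤ ι 1)
    all-errors m m-large X-large = eventually-all n λ where
        zero    _   → 0 , λ l _ → subst (_≤ ι 1)
          (sym (trans (cong (V *_) (error-zero x′ (seq ξ l))) (*-zeroʳ V))) (0≤ι 1)
        (suc i) i<n → subst (λ j → Eventually (λ l → V * error x′ (seq ξ l) (suc j) ≤ ι 1))
          (Fin.toℕ-fromℕ< i<n) (at (Fin.fromℕ< i<n))
      where
      V : ℚ
      V = ι (2 ℕ.^ (c ℕ.* (2 ℕ.+ m)))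

      Y-small : Eventually (λ l → ι (2 ℕ.^ (m ℕ.* suc c)) * seq Y l ≤ ι 2)
      Y-small = eventually-map₂ (λ l → λ (2^≤X , 0≤Y) → root-bound m (suc c) b 2^≤X 0≤Y)
        (eventually-map₂ (λ l → _,_) X-large Y≥0) X^C*Y^b≤2

      at : ∀ (i : Fin n) → Eventually (λ l → V * error x′ (seq ξ l) (suc (toℕ i)) ≤ ι 1)
      at i = let δ , 0<δ , Pδ≡1 = reciprocal (0<ι (2 ℕ.^ (m ℕ.* suc c)) {{ℕ.m^n≢0 2 (m ℕ.* suc c)}}) in
        eventually-map₂ (λ l → weaken-exponent m c m-large (0≤∣p∣ _) Pδ≡1) Y-small (errors δ 0<δ i)

    from-solution : fromℚ (ι (2 ℕ.^ (b ℕ.* suc M₀))) ≤ℝ X → Target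
    -- Rounding costs one step on each side: `r > 2^(b (m + 1))` forces `X ≥ 2^(b m)`, whereas
    -- `∣x₀∣ ≤ r ≤ 2^(b (m + 2))`.
    from-solution B≤X = 2 ℕ.+ m , ℕ.≤-trans M≤m (ℕ.m≤n+m m 2) , x′ , x₀≢0 ,
      ι-cancel-≤ (≤-trans x₀≤r (subst (λ e → r ≤ ι (2 ℕ.^ (b ℕ.* suc e))) (ℕ.+-suc j M₀) r≤)) ,
      all-errors m (ℕ.≤-trans (ℕ.m≤n+m _ M) M₀≤m) (N , X-large)
      where
      oscillation = cauchy X 1ℚ (positive⁻¹ 1ℚ)
      B≤X+1 = B≤X 1ℚ (positive⁻¹ 1ℚ)

      N : ℕ
      N = proj₁ oscillation ℕ.⊔ (proj₁ B≤X+1 ℕ.⊔ proj₁ x₀≤)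

      N≥ : proj₁ B≤X+1 ℕ.⊔ proj₁ x₀≤ ℕ.≤ N
      N≥ = ℕ.m≤n⊔m (proj₁ oscillation) _

      -- The prescribed lower bound and `∣x₀∣` are each at most `seq X N + 1ℚ`; the second unit
      -- makes `B<r` strict, as `bracket` demands.
      r : ℚ
      r = seq X N + ι 2

      p<p+1 : ∀ p → p < p + 1ℚ
      p<p+1 p = subst (_< p + 1ℚ) (+-identityʳ p) (+-monoʳ-< p (positive⁻¹ 1ℚ))

      +1+1 : ∀ p → p + 1ℚ + 1ℚ ≡ p + ι 2
      +1+1 p = trans (+-assoc p 1ℚ 1ℚ) (cong (λ o → p + o) (sym (⟦⟧≡/1 (+ 2))))

      B<r : ι (2 ℕ.^ (b ℕ.* suc M₀)) < r
      B<r = ≤-<-trans (proj₂ B≤X+1 N (ℕ.≤-trans (ℕ.m≤m⊔n _ _) N≥))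
        (subst (seq X N + 1ℚ <_) (+1+1 (seq X N)) (p<p+1 (seq X N + 1ℚ)))

      x₀≤r : ι ℤ.∣ x′ 0 ∣ ≤ r
      x₀≤r = ≤-trans (proj₂ x₀≤ N (ℕ.≤-trans (ℕ.m≤n⊔m (proj₁ B≤X+1) _) N≥))
        (subst (seq X N + 1ℚ ≤_) (+1+1 (seq X N)) (<⇒≤ (p<p+1 (seq X N + 1ℚ))))

      bracketing = bracket b (suc M₀) r B<r

      j : ℕ
      j = proj₁ bracketing

      m : ℕ
      m = j ℕ.+ M₀

      r≤ : r ≤ ι (2 ℕ.^ (b ℕ.* suc (j ℕ.+ suc M₀)))
      r≤ = proj₂ (proj₂ bracketing)

      M₀≤m : M₀ ℕ.≤ m
      M₀≤m = ℕ.m≤n+m M₀ j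

      M≤m : M ℕ.≤ m
      M≤m = ℕ.≤-trans (ℕ.m≤m+n M _) M₀≤m

      2≤m : 2 ℕ.≤ m
      2≤m = ℕ.≤-trans (ℕ.≤-trans (ℕ.m≤n+m 2 (c ℕ.* 2)) (ℕ.m≤n+m _ M)) M₀≤m

      X-large : ∀ l → N ℕ.≤ l → ι (2 ℕ.^ (b ℕ.* m)) ≤ seq X l
      X-large l N≤l = begin
        ι (2 ℕ.^ (b ℕ.* m))
          ≡⟨ solve 2 (λ p q → p := (p :+ q) :- q) refl (ι (2 ℕ.^ (b ℕ.* m))) (ι 3) ⟩
        ι (2 ℕ.^ (b ℕ.* m)) + ι 3 - ι 3
          ≡⟨ cong (_- ι 3) (ι-+ (2 ℕ.^ (b ℕ.* m)) 3) ⟨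
        ι (2 ℕ.^ (b ℕ.* m) ℕ.+ 3) - ι 3
          ≤⟨ +-monoˡ-≤ (- ι 3) (ι-mono (2^-gap b m 2≤m)) ⟩
        ι (2 ℕ.^ (b ℕ.* suc m)) - ι 3
          ≡⟨ cong (λ e → ι (2 ℕ.^ (b ℕ.* e)) - ι 3) (ℕ.+-suc j M₀) ⟨
        ι (2 ℕ.^ (b ℕ.* (j ℕ.+ suc M₀))) - ι 3
          ≤⟨ +-monoˡ-≤ (- ι 3) (<⇒≤ (proj₁ (proj₂ bracketing))) ⟩
        seq X N + ι 2 - ι 3
          ≤⟨ +-monoˡ-≤ (- ι 3) (+-monoˡ-≤ (ι 2) (∣p-q∣≤r⇒p≤q+r (seq X N) (seq X l)
               (proj₂ oscillation N l (ℕ.m≤m⊔n _ _) (ℕ.≤-trans (ℕ.m≤m⊔n _ _) N≤l)))) ⟩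
        seq X l + 1ℚ + ι 2 - ι 3
          ≡⟨ cong (λ o → seq X l + 1ℚ + ι 2 - o) (ι-suc 2) ⟩
        seq X l + 1ℚ + ι 2 - (ι 2 + 1ℚ)
          ≡⟨ solve 3 (λ p q o → p :+ o :+ q :- (q :+ o) := p) refl (seq X l) (ι 2) 1ℚ ⟩
        seq X l ∎
        where open ≤-Reasoning

-- Choosing a fraction with a large denominator.

nonNegative-fraction : ∀ q → 0ℚ ≤ q → ∃[ p ] ∃[ r ] (q * ι (suc r) ≡ ι p)
nonNegative-fraction q@(mkℚ (+ p) r _) _ = p , r ,
  trans (cong (_* ι (suc r)) (sym (↥p/↧p≡p q))) (/-*-cancel (+ p) (suc r))
nonNegative-fraction q@(mkℚ -[1+ p ] r _) 0≤q = contradiction 0≤q (<⇒≱ (negative⁻¹ q))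
  where
  <⇒≱ : ∀ {p q} → p < q → ¬ (q ≤ p)
  <⇒≱ p<q q≤p = <-irrefl refl (<-≤-trans p<q q≤p)

-- The fraction `q = p / (r + 1)` is expanded by `t + 1` until `3 / (k (t + 1)(r + 1))` fits into
-- half of the gap `ε`. Here `3` is the surplus `2` in `c` plus the unit given up in
-- `admissible⇒approximable`. Of the surplus, one unit is lost in `approximable-suc` and the other
-- keeps the final inequality strict.
below⇒approximable : ∀ k .{{_ : ℕ.NonZero k}} ξ {q} → 0ℚ ≤ q → below (λ[ k ] ξ) q →
  ∃[ b ] ∃[ c ] (ι c ≡ q * ι (k ℕ.* suc b) + ι 2 × Approximable k ξ 0 c (k ℕ.* suc b))
below⇒approximable k ξ {q} 0≤q (s , adm , ε , 0<ε , N , q+ε≤s) =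
  let p , r , qr≡p = nonNegative-fraction q 0≤q
      t , 3≤ = archimedes-* {½ * ε} 0<½ε (ι 3)
  -- `r + t (r + 1)` is the predecessor of `(t + 1)(r + 1)`.
  in r ℕ.+ t ℕ.* suc r , p ℕ.* suc t ℕ.* k ℕ.+ 2 ,
     trans (ι-+ (p ℕ.* suc t ℕ.* k) 2) (cong (_+ ι 2) (sym (qb≡ p r t qr≡p))) ,
     admissible⇒approximable {s = s} _ (k ℕ.* (suc t ℕ.* suc r)) {{ℕ.m*n≢0 k (suc t ℕ.* suc r)}} adm
       (½ * ε , 0<½ε , N , λ l N≤l → fraction-bound p r t qr≡p 3≤ (seq s l) (q+ε≤s l N≤l))
  where
  0<½ε : 0ℚ < ½ * ε
  0<½ε = positive⁻¹ (½ * ε) {{pos*pos⇒pos ½ ε {{positive 0<ε}}}}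

  qb≡ : ∀ p r t → q * ι (suc r) ≡ ι p → q * ι (k ℕ.* (suc t ℕ.* suc r)) ≡ ι (p ℕ.* suc t ℕ.* k)
  qb≡ p r t qr≡p = begin
    q * ι (k ℕ.* (suc t ℕ.* suc r))
      ≡⟨ cong (q *_) (trans (ι-* k (suc t ℕ.* suc r)) (cong (ι k *_) (ι-* (suc t) (suc r)))) ⟩
    q * (ι k * (ι (suc t) * ι (suc r)))
      ≡⟨ solve 4 (λ q k t r → q :* (k :* (t :* r)) := q :* r :* t :* k) refl q (ι k) (ι (suc t)) (ι (suc r)) ⟩
    q * ι (suc r) * ι (suc t) * ι k
      ≡⟨ cong (λ o → o * ι (suc t) * ι k) qr≡p ⟩
    ι p * ι (suc t) * ι k
      ≡⟨ trans (ι-* (p ℕ.* suc t) k) (cong (_* ι k) (ι-* p (suc t))) ⟨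
    ι (p ℕ.* suc t ℕ.* k) ∎
    where open ≡-Reasoning

  fraction-bound : ∀ p r t → q * ι (suc r) ≡ ι p → ι 3 ≤ ½ * ε * ι (suc t) → ∀ σ → q + ε ≤ σ →
    - σ + ½ * ε ≤ _/_ (0 ⊖ suc (p ℕ.* suc t ℕ.* k ℕ.+ 2)) (k ℕ.* (suc t ℕ.* suc r)) {{ℕ.m*n≢0 k (suc t ℕ.* suc r)}}
  fraction-bound p r t qr≡p 3≤ σ q+ε≤σ = *-cancelʳ (0<ι b) (begin
    (- σ + ½ * ε) * ι b
      ≤⟨ *-monoʳ (0≤ι b) (+-monoˡ-≤ (½ * ε) (neg-antimono-≤ q+ε≤σ)) ⟩
    (- (q + ε) + ½ * ε) * ι b
      ≡⟨ cong (λ o → (- (q + o) + ½ * ε) * ι b) half+half ⟨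
    (- (q + (½ * ε + ½ * ε)) + ½ * ε) * ι b
      ≡⟨ solve 3 (λ q h b → (:- (q :+ (h :+ h)) :+ h) :* b := :- (q :* b :+ h :* b)) refl q (½ * ε) (ι b) ⟩
    - (q * ι b + ½ * ε * ι b)
      ≤⟨ neg-antimono-≤ (+-mono-≤ (≤-reflexive (sym (qb≡ p r t qr≡p)))
           (≤-trans 3≤ (*-monoˡ (<⇒≤ 0<½ε) (ι-mono t≤b)))) ⟩
    - (ι a + ι 3)
      ≡⟨ cong -_ (trans (sym (ι-+ a 3)) (cong ι (ℕ.+-suc a 2))) ⟩
    - ι (suc (a ℕ.+ 2))
      ≡⟨ +-identityˡ (- ι (suc (a ℕ.+ 2))) ⟨
    0ℚ - ι (suc (a ℕ.+ 2))
      ≡⟨ cong (_- ι (suc (a ℕ.+ 2))) (⟦⟧≡/1 0ℤ) ⟨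
    ι 0 - ι (suc (a ℕ.+ 2))
      ≡⟨ /-⊖ 0 (suc (a ℕ.+ 2)) b ⟨
    ((0 ⊖ suc (a ℕ.+ 2)) / b) * ι b ∎)
    where
    open ≤-Reasoning
    a b : ℕ
    a = p ℕ.* suc t ℕ.* k
    b = k ℕ.* (suc t ℕ.* suc r)
    instance
      b≢0 : ℕ.NonZero b
      b≢0 = ℕ.m*n≢0 k (suc t ℕ.* suc r)
    half+half : ½ * ε + ½ * ε ≡ ε
    half+half = trans (sym (*-distribʳ-+ ε ½ ½)) (*-identityˡ ε)
    t≤b : suc t ℕ.≤ b
    t≤b = ℕ.≤-trans (ℕ.m≤m*n (suc t) (suc r)) (ℕ.m≤n*m (suc t ℕ.* suc r) k)

-- The inequalities, one rational at a time.

below-suc : ∀ ξ k .{{_ : ℕ.NonZero k}} q q′ → ι (suc k) * (1ℚ + q′) ≤ ι k * (1ℚ + q) →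
            below (λ[ k ] ξ) q → below (λ[ suc k ] ξ) q′
below-suc ξ k q q′ h q<λ = by-sign (0ℚ ≤? q)
  where
  open ≤-Reasoning

  [1+k]q′≤kq-1 : ι (suc k) * q′ ≤ ι k * q - 1ℚ
  [1+k]q′≤kq-1 = begin
    ι (suc k) * q′
      ≡⟨ solve 2 (λ n q → n :* q := n :* (con 1ℚ :+ q) :- n) refl (ι (suc k)) q′ ⟩
    ι (suc k) * (1ℚ + q′) - ι (suc k)
      ≤⟨ +-monoˡ-≤ (- ι (suc k)) h ⟩
    ι k * (1ℚ + q) - ι (suc k)
      ≡⟨ cong (λ o → ι k * (1ℚ + q) - o) (ι-suc k) ⟩
    ι k * (1ℚ + q) - (ι k + 1ℚ)
      ≡⟨ solve 2 (λ k q → k :* (con 1ℚ :+ q) :- (k :+ con 1ℚ) := k :* q :- con 1ℚ) refl (ι k) q ⟩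
    ι k * q - 1ℚ ∎

  from-approximation : ∃[ b ] ∃[ c ] (ι c ≡ q * ι (k ℕ.* suc b) + ι 2 ×
    Approximable k ξ 0 c (k ℕ.* suc b)) → below (λ[ suc k ] ξ) q′
  from-approximation (b , c , c≡ , approx) =
    approximable⇒below {q = q′} (suc (suc b)) c (suc k ℕ.* suc b)
      (approximable-suc ξ k (suc b) c approx) (begin-strict
        q′ * ι (suc k ℕ.* suc b)
          ≡⟨ cong (q′ *_) (ι-* (suc k) (suc b)) ⟩
        q′ * (ι (suc k) * ι (suc b))
          ≡⟨ solve 3 (λ q k b → q :* (k :* b) := k :* q :* b) refl q′ (ι (suc k)) (ι (suc b)) ⟩
        ι (suc k) * q′ * ι (suc b)
          ≤⟨ *-monoʳ (0≤ι (suc b)) [1+k]q′≤kq-1 ⟩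
        (ι k * q - 1ℚ) * ι (suc b)
          ≡⟨ solve 4 (λ k q b t → (k :* q :- con 1ℚ) :* b := (q :* (k :* b) :+ t) :- (b :+ t)) refl
               (ι k) q (ι (suc b)) (ι 2) ⟩
        (q * (ι k * ι (suc b)) + ι 2) - (ι (suc b) + ι 2)
          ≡⟨ cong₂ _-_ (trans c≡ (cong (λ o → q * o + ι 2) (ι-* k (suc b)))) (ι-+ (suc b) 2) ⟨
        ι c - ι (suc b ℕ.+ 2)
          <⟨ +-monoʳ-< (ι c) (neg-antimono-< (ι-mono-< (ℕ.≤-reflexive (cong suc (ℕ.+-comm 2 b))))) ⟩
        ι c - ι (suc (suc b)) ∎)

  by-sign : Dec (0ℚ ≤ q) → below (λ[ suc k ] ξ) q′
  by-sign (yes 0≤q) = from-approximation (below⇒approximable k ξ 0≤q q<λ)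
  -- A negative `q` forces `q′` to be negative as well, since `(k + 1) q′ ≤ k q - 1`.
  by-sign (no 0≰q)  = negative-below (suc k) ξ
    (*-cancelˡ-<-nonNeg (ι (suc k)) {{nonNegative (0≤ι (suc k))}} (begin-strict
      ι (suc k) * q′   ≤⟨ [1+k]q′≤kq-1 ⟩
      ι k * q - 1ℚ     <⟨ +-mono-≤-< (*-monoˡ (0≤ι k) (<⇒≤ (≰⇒> 0≰q))) (negative⁻¹ (- 1ℚ)) ⟩
      ι k * 0ℚ + 0ℚ    ≡⟨ trans (+-identityʳ (ι k * 0ℚ)) (trans (*-zeroʳ (ι k)) (sym (*-zeroʳ (ι (suc k))))) ⟩
      ι (suc k) * 0ℚ   ∎))

-- Allows `n (1 + q)` to keep its value while `n` changes.
divide-shift : ∀ n .{{_ : ℕ.NonZero n}} r → ∃[ q ] ι n * (1ℚ + q) ≡ r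
divide-shift n r = let ρ , _ , nρ≡1 = reciprocal (0<ι n) in ρ * r - 1ℚ , (begin
  ι n * (1ℚ + (ρ * r - 1ℚ))   ≡⟨ solve 3 (λ n ρ r → n :* (con 1ℚ :+ (ρ :* r :- con 1ℚ)) := n :* ρ :* r) refl (ι n) ρ r ⟩
  ι n * ρ * r                 ≡⟨ cong (_* r) nρ≡1 ⟩
  1ℚ * r                      ≡⟨ *-identityˡ r ⟩
  r                           ∎)
  where open ≡-Reasoning

-- The intermediate exponents are chosen with equality, so the iteration loses nothing and the slack
-- of the hypothesis is spent in the last step.
below-+ : ∀ ξ k .{{_ : ℕ.NonZero k}} j q q′ → ι (j ℕ.+ k) * (1ℚ + q′) ≤ ι k * (1ℚ + q) →
          below (λ[ k ] ξ) q → below (λ[ j ℕ.+ k ] ξ) q′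
below-+ ξ k zero q q′ h = downwards (λ[ k ] ξ)
  (subst₂ _≤_ (cancel q′) (cancel q) (+-monoʳ-≤ (- 1ℚ) (*-cancelˡ (0<ι k) h)))
  where
  cancel : ∀ p → - 1ℚ + (1ℚ + p) ≡ p
  cancel p = trans (sym (+-assoc (- 1ℚ) 1ℚ p)) (+-identityˡ p)
below-+ ξ k (suc j) q q′ h q<λ =
  let q″ , eq = divide-shift (j ℕ.+ k) (ι k * (1ℚ + q))
  in below-suc ξ (j ℕ.+ k) q″ q′ (≤-trans h (≤-reflexive (sym eq)))
       (below-+ ξ k j q q″ (≤-reflexive eq) q<λ)
  where
  instance
    j+k≢0 : ℕ.NonZero (j ℕ.+ k)
    j+k≢0 = ℕ.>-nonZero (ℕ.≤-trans (ℕ.>-nonZero⁻¹ k) (ℕ.m≤n+m k j))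

theorem2p4 : (ξ : ℝ) → Transcendental ξ →
    (∀ (k : ℕ) .{{_ : ℕ.NonZero k}} →
    suc k · (1ℚ ⊕ λ[ suc k ] ξ) ≥∞ k · (1ℚ ⊕ λ[ k ] ξ))
    ×
    (∀ (k n : ℕ) .{{_ : ℕ.NonZero k}} .{{_ : ℕ.NonZero n}} → k ℕ.≤ n →
    λ[ n ] ξ ≥∞ (((k ⊖ n) / 1) ⊕ k · λ[ k ] ξ) ÷∞ n)
theorem2p4 ξ _ = first , second
  where
  first : ∀ k .{{_ : ℕ.NonZero k}} → suc k · (1ℚ ⊕ λ[ suc k ] ξ) ≥∞ k · (1ℚ ⊕ λ[ k ] ξ)
  first k q (a , (q₀ , q₀<λ , a≤1+q₀) , q≤ka) =
    let q₁ , eq = divide-shift (suc k) (ι k * (1ℚ + q₀))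
    in 1ℚ + q₁ , (q₁ , below-suc ξ k q₀ q₁ (≤-reflexive eq) q₀<λ , ≤-refl) , (begin
      q                          ≤⟨ q≤ka ⟩
      (+ k / 1) * a              ≡⟨ cong (_* a) (⟦⟧≡/1 (+ k)) ⟨
      ι k * a                    ≤⟨ *-monoˡ (0≤ι k) a≤1+q₀ ⟩
      ι k * (1ℚ + q₀)            ≡⟨ eq ⟨
      ι (suc k) * (1ℚ + q₁)      ≡⟨ cong (_* (1ℚ + q₁)) (⟦⟧≡/1 (+ suc k)) ⟩
      (+ suc k / 1) * (1ℚ + q₁)  ∎)
    where open ≤-Reasoning

  second : ∀ k n .{{_ : ℕ.NonZero k}} .{{_ : ℕ.NonZero n}} → k ℕ.≤ n →
           λ[ n ] ξ ≥∞ (((k ⊖ n) / 1) ⊕ k · λ[ k ] ξ) ÷∞ n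
  second k n k≤n q (a , (a′ , (q₀ , q₀<λ , a′≤kq₀) , a≤) , q≤a/n) =
    -- Adding `n` to `n q ≤ (k - n) + k q₀` gives `n (1 + q) ≤ k (1 + q₀)`, the form in which the
    -- inequality iterates.
    subst (λ m → below (λ[ m ] ξ) q) (ℕ.m∸n+n≡m k≤n)
      (below-+ ξ k (n ℕ.∸ k) q₀ q (subst (λ m → ι m * (1ℚ + q) ≤ ι k * (1ℚ + q₀)) (sym (ℕ.m∸n+n≡m k≤n)) (begin
        ι n * (1ℚ + q)
          ≡⟨ solve 2 (λ n q → n :* (con 1ℚ :+ q) := n :+ n :* q) refl (ι n) q ⟩
        ι n + ι n * q
          ≤⟨ +-monoʳ-≤ (ι n) (*-monoˡ (0≤ι n) q≤a/n) ⟩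
        ι n + ι n * ((+ 1 / n) * a)
          ≡⟨ cong (λ o → ι n + o) clear ⟩
        ι n + a
          ≤⟨ +-monoʳ-≤ (ι n) (≤-trans a≤ (+-monoʳ-≤ ((k ⊖ n) / 1) a′≤kq₀)) ⟩
        ι n + ((k ⊖ n) / 1 + (+ k / 1) * q₀)
          ≡⟨ cong₂ (λ u v → ι n + (u + v * q₀)) (trans (sym (⟦⟧≡/1 (k ⊖ n))) (⟦⟧-⊖ k n)) (sym (⟦⟧≡/1 (+ k))) ⟩
        ι n + ((ι k - ι n) + ι k * q₀)
          ≡⟨ solve 3 (λ n k q → n :+ ((k :- n) :+ k :* q) := k :* (con 1ℚ :+ q)) refl (ι n) (ι k) q₀ ⟩
        ι k * (1ℚ + q₀) ∎)) q₀<λ)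
    where
    open ≤-Reasoning
    clear : ι n * ((+ 1 / n) * a) ≡ a
    clear = trans (solve 3 (λ n r a → n :* (r :* a) := r :* n :* a) refl (ι n) (+ 1 / n) a)
      (trans (cong (_* a) (trans (/-*-cancel (+ 1) n) (⟦⟧≡/1 1ℤ))) (*-identityˡ a))
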